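{- Let $CP_3(n)$ be defined by $\sum_{n\ge 0} CP_3(n)q^n = \dfrac{f_3^6f_6^6}{f_1^2f_2^2}$. Then \begin{align*} \sum_{n=0}^\infty CP_3(3n)q^n &= \frac{f_2^2f_3^{18}}{f_1^6f_6^6}+2q\frac{f_3^9f_6^3}{f_1^3f_2}+28q^2\frac{f_6^{12}}{f_2^4},\\ \sum_{n=0}^\infty CP_3(3n+1)q^n &= 2\frac{f_2f_3^{15}}{f_1^5f_6^3}+13q\frac{f_3^6f_6^6}{f_1^2f_2^2}-16q^2\frac{f_1f_6^{15}}{f_2^5f_3^3},\\ \sum_{n=0}^\infty CP_3(3n+2)q^n &= 7\frac{f_3^{12}}{f_1^4}-4q\frac{f_3^3f_6^9}{f_1f_2^3}+16q^2\frac{f_1^2f_6^{18}}{f_2^6f_3^6}. \end{align*}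
   Context: For $|q|<1$ and integer $m\ge 1$, $f_m := (q^m;q^m)_\infty=\prod_{n\ge1}(1-q^{mn})$. $CP_3(n)$ is the number of $3$-core cubic bipartitions of $n$, defined by the generating function $\sum_{n\ge0}CP_3(n)q^n = \frac{f_3^6f_6^6}{f_1^2f_2^2}$. Identities are of formal power series in $q$. -}

module Defs where

open import Data.Nat as ℕ using (ℕ; zero; suc)
open import Data.Integer as ℤ using (ℤ; +_; -_)
open import Data.List using (List; []; _∷_; map; upTo; zipWith; foldr)

sumℤ : List ℤ → ℤ
sumℤ = foldr ℤ._+_ (+ 0)

PS : Set
PS = ℕ → ℤ

𝟙 : PS
𝟙 zero    = + 1
𝟙 (suc _) = + 0

infixl 6 _⊕_ _⊖_
infixl 7 _⊛_ _·_

_⊕_ : PS → PS → PS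
(a ⊕ b) n = a n ℤ.+ b n

_⊖_ : PS → PS → PS
(a ⊖ b) n = a n ℤ.- b n

_·_ : ℤ → PS → PS
(c · a) n = c ℤ.* a n

_⊛_ : PS → PS → PS
(a ⊛ b) n = sumℤ (map (λ i → a i ℤ.* b (n ℕ.∸ i)) (upTo (suc n)))

infixr 8 _^_
_^_ : PS → ℕ → PS
a ^ zero  = 𝟙
a ^ suc k = a ⊛ (a ^ k)

qs : PS → PS
(qs a) zero    = + 0
(qs a) (suc n) = a n

qpow : ℕ → PS
qpow zero    = 𝟙
qpow (suc k) = qs (qpow k)

finProd : ℕ → ℕ → PS
finProd m zero    = 𝟙
finProd m (suc N) = finProd m N ⊛ (𝟙 ⊖ qpow (m ℕ.* suc N))

-- f_m = (q^m;q^m)_∞ = ∏_{k≥1} (1 - q^{m k}).  For m ≥ 1 the factors with k > n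
-- do not affect the coefficient of q^n, so this coefficient is that of the
-- finite product ∏_{k=1}^{n}.
f : ℕ → PS
f m n = finProd m n n

-- Multiplicative inverse of a power series with constant term 1:
-- g_0 = 1, g_{n} = - Σ_{k=1}^{n} a_k g_{n-k}.
-- invL a n = g_n ∷ g_{n-1} ∷ … ∷ g_0.
invL : PS → ℕ → List ℤ
invL a zero    = + 1 ∷ []
invL a (suc n) =
  (- sumℤ (zipWith (λ j g → a (suc j) ℤ.* g) (upTo (suc n)) (invL a n)))
  ∷ invL a n

headℤ : List ℤ → ℤ
headℤ []      = + 0
headℤ (x ∷ _) = x

inv : PS → PS
inv a n = headℤ (invL a n)

f⁻¹ : ℕ → PS
f⁻¹ m = inv (f m)

CP3 : ℕ → ℤ
CP3 = f 3 ^ 6 ⊛ f 6 ^ 6 ⊛ f⁻¹ 1 ^ 2 ⊛ f⁻¹ 2 ^ 2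

{-# OPTIONS --safe #-}
module Submission where

-- With φ = f₁²/f₂ and ψ = f₂²/f₁ we have f₁f₂ = φψ, and the Jacobi triple product writes φ and ψ as
-- theta series whose 3-dissections are again eta quotients.  This gives, with y = f₃f₆ and
-- t = f₂f₃³/(f₁f₆³),
--   f₁f₂ = ŷ(t̂ - q - 2q²/t̂),   â(q) := a(q³).
-- Multiplying by the cofactor in ℤ[[q³]][q] produces the norm of f₁f₂, and the norm of f_m is
-- f_m⁴/f_{3m} for m prime to 3, as seen factor by factor on ∏(1 - q^{mk}).  Hence 1/(f₁f₂) is the
-- cofactor times an eta quotient in q³; squaring it gives the nine terms of the theorem.

-- Expanding the norm of f₁f₂ gives y³(t³ - 7q - 8q²/t³). That this equals (f₁f₂)⁴/(f₃f₆) is a level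
-- 6 modular identity, hard to reach by manipulating eta quotients. It is obtained by evaluating one
-- multiplicative function twice: on the theta dissection and on the infinite product. With ζ
-- running over the cube roots of unity the norm is the product of the a(ζq), read in the variable
-- q³; working with components in ℤ[[q]][X]/(X³ - q) keeps all coefficients integral.
--
-- Limits are taken through congruences modulo q^k, where infinite products and theta series become
-- finite objects. The triple product therefore starts as an identity between Gaussian binomials in
-- any commutative ring. There Q/x need not exist, so y with xy = Q takes its place, and the
-- two-sided sum is split into halves n ≥ 0 and n ≤ 0; the term n = 0, shared by both, accounts for
-- the stray summands 1.

open import Defs
open import Level using (0ℓ)
open import Algebra.Bundles using (CommutativeRing)
open import Algebra.Structures using (IsCommutativeRing)
open import Algebra.Solver.Ring.AlmostCommutativeRing using (fromCommutativeRing; _-Raw-AlmostCommutative⟶_)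
open import Data.Nat as ℕ using (ℕ; zero; suc; z≤n; s≤s)
import Data.Nat.Properties as ℕₚ
import Data.Nat.Tactic.RingSolver as ℕSolver
open import Data.Integer as ℤ using (ℤ; +_)
import Data.Integer.Properties as ℤₚ
open import Data.Integer.Tactic.RingSolver using (solve-∀)
open import Data.Fin using (#_)
open import Data.List using ([]; _∷_; map; upTo; applyUpTo; zipWith)
open import Data.List.Properties using (map-applyUpTo)
open import Data.Maybe using (Maybe; just; nothing)
open import Data.Product using (_,_; _×_)
open import Data.Sum using (_⊎_; inj₁; inj₂)
open import Data.Unit using (⊤; tt)
open import Data.Vec using ([]; _∷_)
open import Function using (_∘_)
open import Relation.Nullary using (yes; no)
import Relation.Binary.PropositionalEquality as ≡
import Relation.Binary.Reasoning.Setoid as SetoidReasoning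

-- Identities in commutative rings

module RingIdentities (R : CommutativeRing 0ℓ 0ℓ)
  (ι : ℤ.+-*-rawRing -Raw-AlmostCommutative⟶ fromCommutativeRing R) where

  open CommutativeRing R hiding (zero)
  open import Algebra.Properties.Semiring.Exp semiring using () renaming (_^_ to _^ᴿ_)
  open import Algebra.Properties.Ring ring using (+-cancelʳ)
  open import Relation.Binary.Reasoning.Setoid setoid
  open _-Raw-AlmostCommutative⟶_ ι using () renaming (⟦_⟧ to ⟦_⟧ᶜ)

  _coeff≟_ : ∀ c d → Maybe (⟦ c ⟧ᶜ ≈ ⟦ d ⟧ᶜ)
  c coeff≟ d with c ℤ.≟ d
  ... | yes c≡d = just (reflexive (≡.cong ⟦_⟧ᶜ c≡d))
  ... | no _    = nothing

  -- A solver constant con c denotes the image of c under ι, which is not 1# definitionally for c = 1;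
  -- below, 1# is entered as x :^ 0 and 0# is first replaced by x - x.
  open import Algebra.Solver.Ring ℤ.+-*-rawRing (fromCommutativeRing R) ι _coeff≟_
    public using (Polynomial; solve; _:=_; _:+_; _:*_; _:-_; _:^_; :-_; con)

  open import Algebra.Solver.CommutativeMonoid *-commutativeMonoid
    public using () renaming (Expr to Monomial; id to ε; _⊕_ to infixl 7 _∙_; solve to solveᴹ; _⊜_ to infix 4 _≜_)

  -- L - M = c (l - r), with the subtractions moved across.
  lincomb : ∀ {L M l r} c → L + c * r ≈ M + c * l → l ≈ r → L ≈ M
  lincomb {L} {M} {l} {r} c e l≈r = +-cancelʳ (c * r) L M (trans e (+-congˡ (*-congˡ l≈r)))

  lincomb₂ : ∀ {L M l r l′ r′} c c′ → L + c * r + c′ * r′ ≈ M + c * l + c′ * l′ → l ≈ r → l′ ≈ r′ → L ≈ M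
  lincomb₂ c c′ e h h′ = lincomb c (lincomb c′ e h′) h

  -- Gaussian binomials and the finite triple product

  module Gauss (Q : Carrier) where

    -- The Gaussian binomial [a+b choose a]. Indexing by the two complementary parts avoids
    -- subtraction and makes its symmetry an exchange of arguments.
    gauss : ℕ → ℕ → Carrier
    gauss zero    b       = 1#
    gauss (suc a) zero    = 1#
    gauss (suc a) (suc b) = gauss a (suc b) + Q ^ᴿ suc a * gauss (suc a) b

    gauss-zeroʳ : ∀ a → gauss a 0 ≈ 1#
    gauss-zeroʳ zero    = refl
    gauss-zeroʳ (suc a) = refl

    -- Both sides are (Q)_{a+b+1} / ((Q)_a (Q)_b), but 1 - Qⁿ need not be invertible, so induction
    -- replaces division. The identity is the difference of the two Pascal rules, whence
    -- `gauss-pascal`.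
    gauss-absorb : ∀ a b → (1# - Q ^ᴿ suc b) * gauss a (suc b) ≈ (1# - Q ^ᴿ suc a) * gauss (suc a) b
    gauss-absorb zero zero    = refl
    gauss-absorb zero (suc b) = lincomb Q
      (solve 3 (λ q w x → let :1 = q :^ 0 in
          (:1 :- q :* (q :* w)) :* :1 :+ q :* ((:1 :- q :* :1) :* x)
        := (:1 :- q :* :1) :* (:1 :+ q :* :1 :* x) :+ q :* ((:1 :- q :* w) :* :1))
        refl Q (Q ^ᴿ b) (gauss 1 b))
      (gauss-absorb zero b)
    gauss-absorb (suc a) zero = lincomb 1#
      (solve 3 (λ q w x → let :1 = q :^ 0 in
          (:1 :- q :* :1) :* (x :+ q :* w :* :1) :+ :1 :* ((:1 :- q :* w) :* :1)
        := (:1 :- q :* (q :* w)) :* :1 :+ :1 :* ((:1 :- q :* :1) :* x))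
        refl Q (Q ^ᴿ a) (gauss a 1))
      (gauss-absorb a zero)
    gauss-absorb (suc a) (suc b) = lincomb₂ 1# (Q ^ᴿ suc (suc a))
      (solve 6 (λ q w v x y z → let :1 = q :^ 0 in
          (:1 :- q :* (q :* v)) :* (x :+ q :* w :* y)
            :+ :1 :* ((:1 :- q :* w) :* y) :+ q :* (q :* w) :* ((:1 :- q :* (q :* w)) :* z)
        := (:1 :- q :* (q :* w)) :* (y :+ q :* (q :* w) :* z)
            :+ :1 :* ((:1 :- q :* (q :* v)) :* x) :+ q :* (q :* w) :* ((:1 :- q :* v) :* y))
        refl Q (Q ^ᴿ a) (Q ^ᴿ b) (gauss a (suc (suc b))) (gauss (suc a) (suc b)) (gauss (suc (suc a)) b))
      (gauss-absorb a (suc b)) (gauss-absorb (suc a) b)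

    gauss-pascal : ∀ a b → gauss (suc a) (suc b) ≈ gauss (suc a) b + Q ^ᴿ suc b * gauss a (suc b)
    gauss-pascal a b = lincomb 1#
      (solve 4 (λ w v x y → let :1 = w :^ 0 in
          x :+ w :* y :+ :1 :* ((:1 :- w) :* y) := y :+ v :* x :+ :1 :* ((:1 :- v) :* x))
        refl (Q ^ᴿ suc a) (Q ^ᴿ suc b) (gauss a (suc b)) (gauss (suc a) b))
      (gauss-absorb a b)

    gauss-sym : ∀ a b → gauss a b ≈ gauss b a
    gauss-sym zero    b       = sym (gauss-zeroʳ b)
    gauss-sym (suc a) zero    = refl
    gauss-sym (suc a) (suc b) = trans
      (+-cong (gauss-sym a (suc b)) (*-congˡ (gauss-sym (suc a) b)))
      (sym (gauss-pascal b a))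

    poch : ℕ → Carrier
    poch zero    = 1#
    poch (suc n) = poch n * (1# - Q ^ᴿ suc n)

    Q^-+ : ∀ a b → Q ^ᴿ (a ℕ.+ b) ≈ Q ^ᴿ a * Q ^ᴿ b
    Q^-+ zero    b = sym (*-identityˡ _)
    Q^-+ (suc a) b = trans (*-congˡ (Q^-+ a b)) (sym (*-assoc Q (Q ^ᴿ a) (Q ^ᴿ b)))

    gauss-poch : ∀ a b → gauss a b * (poch a * poch b) ≈ poch (a ℕ.+ b)
    gauss-poch zero b = solve 1 (λ x → x :^ 0 :* (x :^ 0 :* x) := x) refl (poch b)
    gauss-poch (suc a) zero = begin
      1# * (poch (suc a) * 1#) ≈⟨ solve 1 (λ x → x :^ 0 :* (x :* x :^ 0) := x) refl (poch (suc a)) ⟩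
      poch (suc a)             ≡⟨ ≡.cong (λ n → poch (suc n)) (≡.sym (ℕₚ.+-identityʳ a)) ⟩
      poch (suc a ℕ.+ 0)       ∎
    gauss-poch (suc a) (suc b) = begin
      (gauss a (suc b) + Q ^ᴿ suc a * gauss (suc a) b) * (poch a * (1# - Q ^ᴿ suc a) * (poch b * (1# - Q ^ᴿ suc b)))
        ≈⟨ solve 6 (λ x y p r u v → let :1 = x :^ 0 in
               (x :+ u :* y) :* (p :* (:1 :- u) :* (r :* (:1 :- v)))
            := (:1 :- u) :* (x :* (p :* (r :* (:1 :- v)))) :+ u :* (:1 :- v) :* (y :* (p :* (:1 :- u) :* r)))
             refl (gauss a (suc b)) (gauss (suc a) b) (poch a) (poch b) (Q ^ᴿ suc a) (Q ^ᴿ suc b) ⟩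
      (1# - Q ^ᴿ suc a) * (gauss a (suc b) * (poch a * poch (suc b)))
        + Q ^ᴿ suc a * (1# - Q ^ᴿ suc b) * (gauss (suc a) b * (poch (suc a) * poch b))
        ≈⟨ +-cong (*-congˡ (trans (gauss-poch a (suc b)) (reflexive (≡.cong poch (ℕₚ.+-suc a b)))))
                  (*-congˡ (gauss-poch (suc a) b)) ⟩
      (1# - Q ^ᴿ suc a) * poch (suc (a ℕ.+ b)) + Q ^ᴿ suc a * (1# - Q ^ᴿ suc b) * poch (suc (a ℕ.+ b))
        ≈⟨ solve 3 (λ p u v → let :1 = p :^ 0 in
               (:1 :- u) :* p :+ u :* (:1 :- v) :* p := p :* (:1 :- u :* v))
             refl (poch (suc (a ℕ.+ b))) (Q ^ᴿ suc a) (Q ^ᴿ suc b) ⟩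
      poch (suc (a ℕ.+ b)) * (1# - Q ^ᴿ suc a * Q ^ᴿ suc b)
        ≈⟨ *-congˡ (+-congˡ (-‿cong (sym (Q^-+ (suc a) (suc b))))) ⟩
      poch (suc (a ℕ.+ b)) * (1# - Q ^ᴿ (suc a ℕ.+ suc b)) ≡⟨ ≡.cong (λ n → poch n * (1# - Q ^ᴿ (suc a ℕ.+ suc b))) (≡.sym (ℕₚ.+-suc a b)) ⟩
      poch (suc a ℕ.+ suc b) ∎

    -- The terms n ≥ 0 of the finite triple product, Σ_{n=0}^{a} xⁿ Q^{n(n-1)/2} [a+b choose a-n].
    half : ℕ → ℕ → Carrier → Carrier
    half zero    b x = 1#
    half (suc a) b x = gauss (suc a) b + x * half a (suc b) (x * Q)

    -- Raising a multiplies the two-sided sum by 1 + xQᵃ, which also carries the term n = -1 into n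
    -- = 0. This inflow is the difference of the two binomials; for `suc b` Pascal's rule makes it a
    -- single term. Since `half` raises b at each step, the induction runs in that primed form.
    half-sucˡ : ∀ a b x → half (suc a) b x + gauss a b ≈ (1# + x * Q ^ᴿ a) * half a b x + gauss (suc a) b
    half-sucˡ′ : ∀ a b x → half (suc a) (suc b) x
      ≈ (1# + x * Q ^ᴿ a) * half a (suc b) x + Q ^ᴿ suc a * gauss (suc a) b
    half-sucˡ′ zero b x = solve 3 (λ q x y → let :1 = x :^ 0 in
        :1 :+ q :* :1 :* y :+ x :* :1 := (:1 :+ x :* :1) :* :1 :+ q :* :1 :* y)
      refl Q x (gauss 1 b)
    half-sucˡ′ (suc a) b x = lincomb x
      (solve 7 (λ q x w g h v v′ → let :1 = x :^ 0 in
         g :+ q :* (q :* w) :* h :+ x :* v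
           :+ x :* ((:1 :+ x :* q :* w) :* v′ :+ q :* w :* g)
        := (:1 :+ x :* (q :* w)) :* (g :+ x :* v′) :+ q :* (q :* w) :* h :+ x :* v)
        refl Q x (Q ^ᴿ a) (gauss (suc a) (suc b)) (gauss (suc (suc a)) b)
          (half (suc a) (suc (suc b)) (x * Q)) (half a (suc (suc b)) (x * Q)))
      (half-sucˡ′ a (suc b) (x * Q))
    half-sucˡ a (suc b) x = trans (+-congʳ (half-sucˡ′ a b x))
      (solve 5 (λ k v w g g′ → k :* v :+ w :* g :+ g′ := k :* v :+ (g′ :+ w :* g))
        refl (1# + x * Q ^ᴿ a) (half a (suc b) x) (Q ^ᴿ suc a) (gauss (suc a) b) (gauss a (suc b)))
    half-sucˡ zero zero x = solve 1 (λ x → let :1 = x :^ 0 in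
      :1 :+ x :* :1 :+ :1 := (:1 :+ x :* :1) :* :1 :+ :1) refl x
    half-sucˡ (suc a) zero x = lincomb x
      (solve 5 (λ q x w v v′ → let :1 = x :^ 0 in
         :1 :+ x :* v :+ :1 :+ x :* ((:1 :+ x :* q :* w) :* v′ :+ q :* w :* :1)
        := (:1 :+ x :* (q :* w)) :* (:1 :+ x :* v′) :+ :1 :+ x :* v)
        refl Q x (Q ^ᴿ a) (half (suc a) 1 (x * Q)) (half a 1 (x * Q)))
      (half-sucˡ′ a zero (x * Q))

    -- Here u stands for Q^(b+1)/x, which need not exist. Multiplication by 1 + u moves terms down
    -- by one, and the image of the term n = 0 leaves the half: this is the correction on the left.
    half-sucʳ : ∀ a b x u → u * x ≈ Q ^ᴿ suc b → half a (suc b) x + u * gauss a b ≈ (1# + u) * half a b x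
    half-sucʳ zero b x u e = solve 1 (λ u → let :1 = u :^ 0 in :1 :+ u :* :1 := (:1 :+ u) :* :1) refl u
    half-sucʳ (suc a) b x u e = lincomb₂ 1# x
      (solve 7 (λ x u G g h v v′ → let :1 = x :^ 0 in
          G :+ x :* v :+ u :* g :+ :1 :* (g :+ u :* x :* h) :+ x :* ((:1 :+ u) :* v′)
        := (:1 :+ u) :* (g :+ x :* v′) :+ :1 :* G :+ x :* (v :+ u :* h))
        refl x u (gauss (suc a) (suc b)) (gauss (suc a) b) (gauss a (suc b))
          (half a (suc (suc b)) (x * Q)) (half a (suc b) (x * Q)))
      (trans (gauss-pascal a b) (+-congˡ (*-congʳ (sym e))))
      (half-sucʳ a (suc b) (x * Q) u (trans (sym (*-assoc u x Q)) (trans (*-congʳ e) (*-comm (Q ^ᴿ suc b) Q))))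

    prod : Carrier → ℕ → Carrier
    prod x zero    = 1#
    prod x (suc a) = prod x a * (1# + x * Q ^ᴿ a)

    prod-cong : ∀ {x y} → x ≈ y → ∀ a → prod x a ≈ prod y a
    prod-cong e zero    = refl
    prod-cong e (suc a) = *-cong (prod-cong e a) (+-congˡ (*-congʳ e))

    prod-shift : ∀ x a → prod x (suc a) ≈ (1# + x) * prod (x * Q) a
    prod-shift x zero    = solve 1 (λ x → let :1 = x :^ 0 in
      :1 :* (:1 :+ x :* :1) := (:1 :+ x) :* :1) refl x
    prod-shift x (suc a) = trans (*-congʳ (prod-shift x a))
      (solve 4 (λ x q w p → let :1 = x :^ 0 in
          (:1 :+ x) :* p :* (:1 :+ x :* (q :* w)) := (:1 :+ x) :* (p :* (:1 :+ x :* q :* w)))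
        refl x Q (Q ^ᴿ a) (prod (x * Q) a))

    -- The q-binomial theorem, the case of the triple product with one factor empty.
    prod≈half : ∀ x a → prod x a ≈ half a 0 x
    prod≈half x zero    = refl
    prod≈half x (suc a) = begin
      prod x a * (1# + x * Q ^ᴿ a)   ≈⟨ *-comm (prod x a) (1# + x * Q ^ᴿ a) ⟩
      (1# + x * Q ^ᴿ a) * prod x a   ≈⟨ *-congˡ (prod≈half x a) ⟩
      (1# + x * Q ^ᴿ a) * half a 0 x ≈⟨ +-cancelʳ (gauss a 0) _ _ (trans (half-sucˡ a 0 x)
                                         (+-congˡ (sym (gauss-zeroʳ a)))) ⟨
      half (suc a) 0 x              ∎

    -- Induction on a alone: the new factor 1 + xQᵃ acts on the half in x by `half-sucˡ` and on the
    -- half in y by `half-sucʳ`. The term n = 0 lies in both halves, hence the binomial added on the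
    -- left.
    triple-product : ∀ x y → x * y ≈ Q → ∀ a b → prod x a * prod y b + gauss a b ≈ half a b x + half b a y
    triple-product x y xy zero b = begin
      1# * prod y b + 1#   ≈⟨ +-comm _ 1# ⟩
      1# + 1# * prod y b   ≈⟨ +-congˡ (trans (*-identityˡ (prod y b)) (prod≈half y b)) ⟩
      1# + half b 0 y      ∎
    triple-product x y xy (suc a) b = lincomb₂ (1# + x * Q ^ᴿ a) 1#
      (solve 9 (λ p r k g g′ v′ v w′ w → let :1 = p :^ 0 in
          p :* (:1 :+ k) :* r :+ g′ :+ (:1 :+ k) :* (v :+ w) :+ :1 :* (v′ :+ g :+ (w′ :+ k :* g))
        := v′ :+ w′ :+ (:1 :+ k) :* (p :* r :+ g) :+ :1 :* ((:1 :+ k) :* v :+ g′ :+ (:1 :+ k) :* w))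
        refl (prod x a) (prod y b) (x * Q ^ᴿ a) (gauss a b) (gauss (suc a) b)
          (half (suc a) b x) (half a b x) (half b (suc a) y) (half b a y))
      (triple-product x y xy a b)
      (sym (+-cong (half-sucˡ a b x)
        (trans (+-congˡ (*-congˡ (gauss-sym a b))) (half-sucʳ b a y (x * Q ^ᴿ a) shift))))
      where
      shift : x * Q ^ᴿ a * y ≈ Q ^ᴿ suc a
      shift = trans (solve 3 (λ x y w → x :* w :* y := x :* y :* w) refl x y (Q ^ᴿ a)) (*-congʳ xy)

  -- The partial sums Σ_{j<n} xʲ Q^{j(j-1)/2}.
  theta : Carrier → ℕ → Carrier → Carrier
  theta Q zero    x = 0#
  theta Q (suc n) x = 1# + x * theta Q n (x * Q)

  theta-cong : ∀ {Q Q′ x x′} → Q ≈ Q′ → x ≈ x′ → ∀ n → theta Q n x ≈ theta Q′ n x′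
  theta-cong q e zero    = refl
  theta-cong q e (suc n) = +-congˡ (*-cong e (theta-cong q (*-cong e q) n))

  -- Sort j by its residue modulo 3: the exponents j(j-1)/2 at 3i, 3i+1, 3i+2 are 9i(i-1)/2 plus 3i,
  -- 6i, 9i+1.
  theta-trisect : ∀ Q x n → theta Q (n ℕ.* 3) x
    ≈ theta (Q ^ᴿ 9) n (x ^ᴿ 3 * Q ^ᴿ 3) + x * theta (Q ^ᴿ 9) n (x ^ᴿ 3 * Q ^ᴿ 6)
      + x * x * Q * theta (Q ^ᴿ 9) n (x ^ᴿ 3 * Q ^ᴿ 9)
  theta-trisect Q x zero = sym (trans (+-cong (trans (+-identityˡ _) (zeroʳ x)) (zeroʳ _)) (+-identityˡ 0#))
  theta-trisect Q x (suc n) = begin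
    1# + x * (1# + x * Q * (1# + x * Q * Q * theta Q (n ℕ.* 3) x₃))
      ≈⟨ +-congˡ (*-congˡ (+-congˡ (*-congˡ (+-congˡ (*-congˡ (trans (theta-trisect Q x₃ n) shift)))))) ⟩
    1# + x * (1# + x * Q * (1# + x * Q * Q * (A + x₃ * B + x₃ * x₃ * Q * C)))
      ≈⟨ solve 5 (λ x q a b c → let :1 = x :^ 0 in
           :1 :+ x :* (:1 :+ x :* q :* (:1 :+ x :* q :* q :*
             (a :+ x :* q :* q :* q :* b :+ x :* q :* q :* q :* (x :* q :* q :* q) :* q :* c)))
        := :1 :+ x :^ 3 :* q :^ 3 :* a :+ x :* (:1 :+ x :^ 3 :* q :^ 6 :* b)
             :+ x :* x :* q :* (:1 :+ x :^ 3 :* q :^ 9 :* c)) refl x Q A B C ⟩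
    1# + x ^ᴿ 3 * Q ^ᴿ 3 * A + x * (1# + x ^ᴿ 3 * Q ^ᴿ 6 * B) + x * x * Q * (1# + x ^ᴿ 3 * Q ^ᴿ 9 * C) ∎
    where
    x₃ A B C : Carrier
    x₃ = x * Q * Q * Q
    A = theta (Q ^ᴿ 9) n (x ^ᴿ 3 * Q ^ᴿ 3 * Q ^ᴿ 9)
    B = theta (Q ^ᴿ 9) n (x ^ᴿ 3 * Q ^ᴿ 6 * Q ^ᴿ 9)
    C = theta (Q ^ᴿ 9) n (x ^ᴿ 3 * Q ^ᴿ 9 * Q ^ᴿ 9)
    cube : ∀ w → x₃ ^ᴿ 3 * w ≈ x ^ᴿ 3 * w * Q ^ᴿ 9
    cube w = solve 3 (λ x q w → (x :* q :* q :* q) :^ 3 :* w := x :^ 3 :* w :* q :^ 9) refl x Q w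
    shift : theta (Q ^ᴿ 9) n (x₃ ^ᴿ 3 * Q ^ᴿ 3) + x₃ * theta (Q ^ᴿ 9) n (x₃ ^ᴿ 3 * Q ^ᴿ 6)
      + x₃ * x₃ * Q * theta (Q ^ᴿ 9) n (x₃ ^ᴿ 3 * Q ^ᴿ 9) ≈ A + x₃ * B + x₃ * x₃ * Q * C
    shift = +-cong (+-cong (theta-cong refl (cube (Q ^ᴿ 3)) n) (*-congˡ (theta-cong refl (cube (Q ^ᴿ 6)) n)))
                   (*-congˡ (theta-cong refl (cube (Q ^ᴿ 9)) n))

  -- The norm from R[X]/(X³ - q) down to R.
  norm : Carrier → Carrier → Carrier → Carrier → Carrier
  norm q a b c = a * a * a + q * (b * b * b) + q * q * (c * c * c) - (1# + 1# + 1#) * (q * (a * b * c))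

  norm-cong : ∀ q {a a′ b b′ c c′} → a ≈ a′ → b ≈ b′ → c ≈ c′ → norm q a b c ≈ norm q a′ b′ c′
  norm-cong q ea eb ec = +-cong
    (+-cong (+-cong (*-cong (*-cong ea ea) ea) (*-congˡ (*-cong (*-cong eb eb) eb)))
            (*-congˡ (*-cong (*-cong ec ec) ec)))
    (-‿cong (*-congˡ (*-congˡ (*-cong (*-cong ea eb) ec))))

  :norm : ∀ {n} (q a b c : Polynomial n) → Polynomial n
  :norm q a b c = let :1 = q :^ 0 in
    a :* a :* a :+ q :* (b :* b :* b) :+ q :* q :* (c :* c :* c) :- (:1 :+ :1 :+ :1) :* (q :* (a :* b :* c))

  norm-* : ∀ q a b c a′ b′ c′ →
    norm q (a * a′ + q * (b * c′ + c * b′)) (a * b′ + b * a′ + q * (c * c′)) (a * c′ + b * b′ + c * a′)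
    ≈ norm q a b c * norm q a′ b′ c′
  norm-* = solve 7 (λ q a b c a′ b′ c′ →
      :norm q (a :* a′ :+ q :* (b :* c′ :+ c :* b′)) (a :* b′ :+ b :* a′ :+ q :* (c :* c′)) (a :* c′ :+ b :* b′ :+ c :* a′)
      := :norm q a b c :* :norm q a′ b′ c′) refl

  0≈x-x : ∀ x → 0# ≈ x - x
  0≈x-x x = sym (-‿inverseʳ x)

  norm-scalar : ∀ q e → norm q e 0# 0# ≈ e * e * e
  norm-scalar q e = trans (norm-cong q refl (0≈x-x q) (0≈x-x q))
    (solve 2 (λ q e → :norm q e (q :- q) (q :- q) := e :* e :* e) refl q e)

  norm-1-X : ∀ q w → norm q 1# (- w) 0# ≈ 1# - q * (w * w * w)
  norm-1-X q w = trans (norm-cong q refl refl (0≈x-x q))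
    (solve 2 (λ q w → let :1 = q :^ 0 in :norm q :1 (:- w) (q :- q) := :1 :- q :* (w :* w :* w)) refl q w)

  norm-1-X² : ∀ q w → norm q 1# 0# (- w) ≈ 1# - q * (q * (w * w * w))
  norm-1-X² q w = trans (norm-cong q refl (0≈x-x q) refl)
    (solve 2 (λ q w → let :1 = q :^ 0 in :norm q :1 (q :- q) (:- w) := :1 :- q :* (q :* (w :* w :* w))) refl q w)

  quotient : ∀ {u v x z} → u * v ≈ 1# → u * x ≈ z → x ≈ z * v
  quotient {u} {v} {x} {z} uv ux = lincomb₂ (- x) v
    (solve 4 (λ u v x z → let :1 = u :^ 0 in
        x :+ :- x :* :1 :+ v :* z := z :* v :+ :- x :* (u :* v) :+ v :* (u :* x)) refl u v x z) uv ux

  -- The summand u comes from the term n = 0 that a triple product counts twice.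
  quotient-1 : ∀ {u v x z} → u * v ≈ 1# → u * x ≈ z + u → x - 1# ≈ z * v
  quotient-1 {u} {v} {x} {z} uv ux = lincomb₂ (1# - x) v
    (solve 4 (λ u v x z → let :1 = u :^ 0 in
        x :- :1 :+ (:1 :- x) :* :1 :+ v :* (z :+ u)
          := z :* v :+ (:1 :- x) :* (u :* v) :+ v :* (u :* x)) refl u v x z) uv ux

  -- This and the next two are the components of (a + bX)(c + dX) modulo X³ = q, in the shape in
  -- which `tri-⊗` delivers them.
  linear₀ : ∀ q a b c d → a * c + q * (b * 0# + 0# * d) ≈ a * c
  linear₀ q a b c d = trans (+-congˡ (trans (*-congˡ (trans (+-cong (zeroʳ b) (zeroˡ d)) (+-identityˡ 0#))) (zeroʳ q)))
    (+-identityʳ _)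

  linear₁ : ∀ q a b c d → a * d + b * c + q * (0# * 0#) ≈ a * d + b * c
  linear₁ q a b c d = trans (+-congˡ (trans (*-congˡ (zeroˡ 0#)) (zeroʳ q))) (+-identityʳ _)

  linear₂ : ∀ a b c d → a * 0# + b * d + 0# * c ≈ b * d
  linear₂ a b c d = trans (+-cong (trans (+-congʳ (zeroʳ a)) (+-identityˡ _)) (zeroˡ c)) (+-identityʳ _)

-- The ring of power series

open ≡ using (_≡_; refl; sym; trans; cong; cong₂; module ≡-Reasoning)
open import Data.Integer using (-_)

𝟘 : PS
𝟘 _ = + 0

⊝_ : PS → PS
(⊝ a) n = - a n

tail : PS → PS
tail a n = a (suc n)

map-upTo-suc : ∀ {A : Set} (g : ℕ → A) m → map g (applyUpTo suc m) ≡ map (g ∘ suc) (upTo m)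
map-upTo-suc g m = trans (map-applyUpTo suc g m) (sym (map-applyUpTo (λ i → i) (g ∘ suc) m))

⊛-zero : ∀ a b → (a ⊛ b) 0 ≡ a 0 ℤ.* b 0
⊛-zero a b = ℤₚ.+-identityʳ _

-- Writing a as a₀ + q·`tail a` turns the Cauchy sum into a recursion, along which the ring laws are
-- proved coefficient by coefficient.
⊛-suc : ∀ a b n → (a ⊛ b) (suc n) ≡ a 0 ℤ.* b (suc n) ℤ.+ (tail a ⊛ b) n
⊛-suc a b n = cong (λ s → a 0 ℤ.* b (suc n) ℤ.+ sumℤ s)
  (map-upTo-suc (λ i → a i ℤ.* b (suc n ℕ.∸ i)) (suc n))

⊛-sucʳ : ∀ a b n → (a ⊛ b) (suc n) ≡ a (suc n) ℤ.* b 0 ℤ.+ (a ⊛ tail b) n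
⊛-sucʳ a b zero
  rewrite ⊛-suc a b 0 | ⊛-zero (tail a) b | ⊛-zero a (tail b) = ℤₚ.+-comm (a 0 ℤ.* b 1) _
⊛-sucʳ a b (suc n)
  rewrite ⊛-suc a b (suc n) | ⊛-sucʳ (tail a) b n | ⊛-suc a (tail b) n =
  swap (a 0 ℤ.* b (suc (suc n))) (a (suc (suc n)) ℤ.* b 0) ((tail a ⊛ tail b) n)
  where
  swap : ∀ x y z → x ℤ.+ (y ℤ.+ z) ≡ y ℤ.+ (x ℤ.+ z)
  swap = solve-∀

⊛-comm-at : ∀ a b n → (a ⊛ b) n ≡ (b ⊛ a) n
⊛-comm-at a b zero rewrite ⊛-zero a b | ⊛-zero b a = ℤₚ.*-comm (a 0) (b 0)
⊛-comm-at a b (suc n)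
  rewrite ⊛-suc a b n | ⊛-sucʳ b a n | ⊛-comm-at (tail a) b n | ℤₚ.*-comm (a 0) (b (suc n)) = refl

-- A coefficient of a product sees only coefficients of no higher index. This makes equality modulo
-- q^k a congruence.
⊛-cong-at : ∀ a a′ b b′ n → (∀ i → i ℕ.≤ n → a i ≡ a′ i) → (∀ i → i ℕ.≤ n → b i ≡ b′ i) →
            (a ⊛ b) n ≡ (a′ ⊛ b′) n
⊛-cong-at a a′ b b′ zero ea eb
  rewrite ⊛-zero a b | ⊛-zero a′ b′ = cong₂ ℤ._*_ (ea 0 z≤n) (eb 0 z≤n)
⊛-cong-at a a′ b b′ (suc n) ea eb rewrite ⊛-suc a b n | ⊛-suc a′ b′ n =
  cong₂ ℤ._+_ (cong₂ ℤ._*_ (ea 0 z≤n) (eb (suc n) ℕₚ.≤-refl))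
    (⊛-cong-at (tail a) (tail a′) b b′ n (λ i l → ea (suc i) (s≤s l)) (λ i l → eb i (ℕₚ.m≤n⇒m≤1+n l)))

⊛-distribʳ-at : ∀ c a b n → ((a ⊕ b) ⊛ c) n ≡ (a ⊛ c ⊕ b ⊛ c) n
⊛-distribʳ-at c a b zero rewrite ⊛-zero (a ⊕ b) c | ⊛-zero a c | ⊛-zero b c =
  ℤₚ.*-distribʳ-+ (c 0) (a 0) (b 0)
⊛-distribʳ-at c a b (suc n)
  rewrite ⊛-suc (a ⊕ b) c n | ⊛-suc a c n | ⊛-suc b c n | ⊛-distribʳ-at c (tail a) (tail b) n =
  rearrange (a 0) (b 0) (c (suc n)) _ _
  where
  rearrange : ∀ x y z u v → (x ℤ.+ y) ℤ.* z ℤ.+ (u ℤ.+ v) ≡ x ℤ.* z ℤ.+ u ℤ.+ (y ℤ.* z ℤ.+ v)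
  rearrange = solve-∀

·-⊛-at : ∀ c a b n → ((c · a) ⊛ b) n ≡ (c · (a ⊛ b)) n
·-⊛-at c a b zero rewrite ⊛-zero (c · a) b | ⊛-zero a b = ℤₚ.*-assoc c (a 0) (b 0)
·-⊛-at c a b (suc n) rewrite ⊛-suc (c · a) b n | ⊛-suc a b n | ·-⊛-at c (tail a) b n =
  rearrange c (a 0) (b (suc n)) _
  where
  rearrange : ∀ c x y z → c ℤ.* x ℤ.* y ℤ.+ c ℤ.* z ≡ c ℤ.* (x ℤ.* y ℤ.+ z)
  rearrange = solve-∀

⊛-assoc-at : ∀ a b c n → ((a ⊛ b) ⊛ c) n ≡ (a ⊛ (b ⊛ c)) n
⊛-assoc-at a b c zero
  rewrite ⊛-zero (a ⊛ b) c | ⊛-zero a b | ⊛-zero a (b ⊛ c) | ⊛-zero b c = ℤₚ.*-assoc (a 0) (b 0) (c 0)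
⊛-assoc-at a b c (suc n) = begin
  ((a ⊛ b) ⊛ c) (suc n)
    ≡⟨ ⊛-suc (a ⊛ b) c n ⟩
  (a ⊛ b) 0 ℤ.* c (suc n) ℤ.+ (tail (a ⊛ b) ⊛ c) n
    ≡⟨ cong₂ ℤ._+_ (cong (ℤ._* c (suc n)) (⊛-zero a b))
         (⊛-cong-at _ (a 0 · tail b ⊕ tail a ⊛ b) c c n (λ i _ → ⊛-suc a b i) (λ _ _ → refl)) ⟩
  a 0 ℤ.* b 0 ℤ.* c (suc n) ℤ.+ ((a 0 · tail b ⊕ tail a ⊛ b) ⊛ c) n
    ≡⟨ cong (λ s → a 0 ℤ.* b 0 ℤ.* c (suc n) ℤ.+ s) (trans (⊛-distribʳ-at c (a 0 · tail b) (tail a ⊛ b) n)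
         (cong₂ ℤ._+_ (·-⊛-at (a 0) (tail b) c n) (⊛-assoc-at (tail a) b c n))) ⟩
  a 0 ℤ.* b 0 ℤ.* c (suc n) ℤ.+ (a 0 ℤ.* (tail b ⊛ c) n ℤ.+ (tail a ⊛ (b ⊛ c)) n)
    ≡⟨ rearrange (a 0) (b 0) (c (suc n)) _ _ ⟩
  a 0 ℤ.* (b 0 ℤ.* c (suc n) ℤ.+ (tail b ⊛ c) n) ℤ.+ (tail a ⊛ (b ⊛ c)) n
    ≡⟨ cong (λ s → a 0 ℤ.* s ℤ.+ (tail a ⊛ (b ⊛ c)) n) (⊛-suc b c n) ⟨
  a 0 ℤ.* (b ⊛ c) (suc n) ℤ.+ (tail a ⊛ (b ⊛ c)) n
    ≡⟨ ⊛-suc a (b ⊛ c) n ⟨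
  (a ⊛ (b ⊛ c)) (suc n) ∎
  where
  open ≡-Reasoning
  rearrange : ∀ x y z u v → x ℤ.* y ℤ.* z ℤ.+ (x ℤ.* u ℤ.+ v) ≡ x ℤ.* (y ℤ.* z ℤ.+ u) ℤ.+ v
  rearrange = solve-∀

⊛-zeroˡ-at : ∀ a n → (𝟘 ⊛ a) n ≡ + 0
⊛-zeroˡ-at a zero = ⊛-zero 𝟘 a
⊛-zeroˡ-at a (suc n) rewrite ⊛-suc 𝟘 a n | ⊛-zeroˡ-at a n = refl

⊛-identityˡ-at : ∀ a n → (𝟙 ⊛ a) n ≡ a n
⊛-identityˡ-at a zero = trans (⊛-zero 𝟙 a) (ℤₚ.*-identityˡ (a 0))
⊛-identityˡ-at a (suc n) rewrite ⊛-suc 𝟙 a n | ⊛-zeroˡ-at a n | ℤₚ.*-identityˡ (a (suc n)) = ℤₚ.+-identityʳ _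

-- Equality modulo q^k (precision just k), or of whole series (precision nothing).
Precision : Set
Precision = Maybe ℕ

_<ᵖ_ : ℕ → Precision → Set
n <ᵖ just k  = n ℕ.< k
n <ᵖ nothing = ⊤

≤-<ᵖ-trans : ∀ {m n} p → m ℕ.≤ n → n <ᵖ p → m <ᵖ p
≤-<ᵖ-trans (just k) l h = ℕₚ.≤-<-trans l h
≤-<ᵖ-trans nothing  _ _ = tt

infix 4 _≈[_]_ _≈_
record _≈[_]_ (a : PS) (p : Precision) (b : PS) : Set where
  constructor mk
  field at : ∀ n → n <ᵖ p → a n ≡ b n
open _≈[_]_ public

_≈_ : PS → PS → Set
a ≈ b = a ≈[ nothing ] b

pointwise : ∀ {a b p} → (∀ n → a n ≡ b n) → a ≈[ p ] b
pointwise h = mk λ n _ → h n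

-- The conversion checker expands products of series coefficientwise, at exponential cost; the ring
-- of series is therefore built on sealed copies of the operations.
infixl 6 _⊞_
infixl 7 _⊗_
infix  8 ⊟_

opaque
  _⊞_ _⊗_ : PS → PS → PS
  _⊞_ = _⊕_
  _⊗_ = _⊛_

  ⊟_ : PS → PS
  ⊟_ = ⊝_

  ⊞-at : ∀ a b n → (a ⊞ b) n ≡ a n ℤ.+ b n
  ⊞-at a b n = refl

  ⊟-at : ∀ a n → (⊟ a) n ≡ - a n
  ⊟-at a n = refl

  ⊞-cong : ∀ {p a a′ b b′} → a ≈[ p ] a′ → b ≈[ p ] b′ → a ⊞ b ≈[ p ] a′ ⊞ b′
  ⊞-cong e e′ = mk λ n h → cong₂ ℤ._+_ (at e n h) (at e′ n h)

  ⊟-cong : ∀ {p a a′} → a ≈[ p ] a′ → ⊟ a ≈[ p ] ⊟ a′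
  ⊟-cong e = mk λ n h → cong -_ (at e n h)

  ⊗-cong : ∀ {p a a′ b b′} → a ≈[ p ] a′ → b ≈[ p ] b′ → a ⊗ b ≈[ p ] a′ ⊗ b′
  ⊗-cong {p} e e′ = mk λ n n<p → ⊛-cong-at _ _ _ _ n
    (λ i i≤n → at e i (≤-<ᵖ-trans p i≤n n<p)) (λ i i≤n → at e′ i (≤-<ᵖ-trans p i≤n n<p))

  psRing-isCommutativeRing : ∀ p → IsCommutativeRing _≈[ p ]_ _⊞_ _⊗_ ⊟_ 𝟘 𝟙
  psRing-isCommutativeRing p = record
      { isRing = record
        { +-isAbelianGroup = record
          { isGroup = record
            { isMonoid = record
              { isSemigroup = record
                { isMagma = record
                  { isEquivalence = record
                    { refl  = pointwise λ _ → refl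
                    ; sym   = λ e → mk λ n h → sym (at e n h)
                    ; trans = λ e e′ → mk λ n h → trans (at e n h) (at e′ n h)
                    }
                  ; ∙-cong = λ e e′ → mk λ n h → cong₂ ℤ._+_ (at e n h) (at e′ n h)
                  }
                ; assoc = λ a b c → pointwise λ n → ℤₚ.+-assoc (a n) (b n) (c n)
                }
              ; identity = (λ a → pointwise λ n → ℤₚ.+-identityˡ (a n)) , (λ a → pointwise λ n → ℤₚ.+-identityʳ (a n))
              }
            ; inverse = (λ a → pointwise λ n → ℤₚ.+-inverseˡ (a n)) , (λ a → pointwise λ n → ℤₚ.+-inverseʳ (a n))
            ; ⁻¹-cong = λ e → mk λ n h → cong -_ (at e n h)
            }
          ; comm = λ a b → pointwise λ n → ℤₚ.+-comm (a n) (b n)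
          }
        ; *-cong = ⊗-cong
        ; *-assoc = λ a b c → pointwise (⊛-assoc-at a b c)
        ; *-identity = (λ a → pointwise (⊛-identityˡ-at a))
                     , (λ a → pointwise λ n → trans (⊛-comm-at a 𝟙 n) (⊛-identityˡ-at a n))
        ; distrib = (λ c a b → pointwise λ n → trans (⊛-comm-at c (a ⊕ b) n) (trans (⊛-distribʳ-at c a b n)
                       (cong₂ ℤ._+_ (⊛-comm-at a c n) (⊛-comm-at b c n))))
                  , (λ c a b → pointwise (⊛-distribʳ-at c a b))
        }
      ; *-comm = λ a b → pointwise (⊛-comm-at a b)
      }

-- One carrier with a ring structure for every precision, so that exact solver identities can be
-- used inside calculations modulo q^k.
psRing : Precision → CommutativeRing 0ℓ 0ℓ
psRing p = record { isCommutativeRing = psRing-isCommutativeRing p }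

const : ℤ → PS
const c zero    = c
const c (suc _) = + 0

const-⊛-at : ∀ c a n → (const c ⊛ a) n ≡ (c · a) n
const-⊛-at c a zero = ⊛-zero (const c) a
const-⊛-at c a (suc n) rewrite ⊛-suc (const c) a n | ⊛-zeroˡ-at a n = ℤₚ.+-identityʳ _

opaque
  unfolding _⊞_

  const-⊞ : ∀ p c d → const (c ℤ.+ d) ≈[ p ] const c ⊞ const d
  const-⊞ p c d = pointwise λ { zero → refl ; (suc n) → refl }

  const-⊗ : ∀ p c d → const (c ℤ.* d) ≈[ p ] const c ⊗ const d
  const-⊗ p c d = pointwise λ
    { zero    → sym (const-⊛-at c (const d) zero)
    ; (suc n) → sym (trans (const-⊛-at c (const d) (suc n)) (ℤₚ.*-zeroʳ c)) }

  const-⊟ : ∀ p c → const (- c) ≈[ p ] ⊟ const c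
  const-⊟ p c = pointwise λ { zero → refl ; (suc n) → refl }

constHom : ∀ p → ℤ.+-*-rawRing -Raw-AlmostCommutative⟶ fromCommutativeRing (psRing p)
constHom p = record
  { ⟦_⟧    = const
  ; +-homo = const-⊞ p
  ; *-homo = const-⊗ p
  ; -‿homo = const-⊟ p
  ; 0-homo = pointwise λ { zero → refl ; (suc n) → refl }
  ; 1-homo = pointwise λ { zero → refl ; (suc n) → refl }
  }

module PSₚ (p : Precision) = CommutativeRing (psRing p)
module PSR = CommutativeRing (psRing nothing)
module Exact = RingIdentities (psRing nothing) (constHom nothing)
open Exact
open import Algebra.Properties.Semiring.Exp PSR.semiring using () renaming (_^_ to _^ᴿ_)

-- Passing between truncated and exact equality

≈-weaken : ∀ {a b} p → a ≈ b → a ≈[ p ] b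
≈-weaken p e = mk λ n _ → at e n tt

≈-weaken-≤ : ∀ {a b k m} → k ℕ.≤ m → a ≈[ just m ] b → a ≈[ just k ] b
≈-weaken-≤ k≤m e = mk λ n n<k → at e n (ℕₚ.<-≤-trans n<k k≤m)

-- The passage to the limit: finite products and partial sums are compared modulo q^k, for each k.
≈-from-truncations : ∀ {a b} → (∀ k → a ≈[ just k ] b) → a ≈ b
≈-from-truncations h = pointwise λ n → at (h (suc n)) n (ℕₚ.n<1+n n)

⊗-congˡ : ∀ {p} a {b b′} → b ≈[ p ] b′ → a ⊗ b ≈[ p ] a ⊗ b′
⊗-congˡ {p} a = ⊗-cong (PSₚ.refl p {a})

⊗-congʳ : ∀ {p} b {a a′} → a ≈[ p ] a′ → a ⊗ b ≈[ p ] a′ ⊗ b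
⊗-congʳ {p} b e = ⊗-cong e (PSₚ.refl p {b})

⊞-congˡ : ∀ {p} a {b b′} → b ≈[ p ] b′ → a ⊞ b ≈[ p ] a ⊞ b′
⊞-congˡ {p} a = ⊞-cong (PSₚ.refl p {a})

⊞-congʳ : ∀ {p} b {a a′} → a ≈[ p ] a′ → a ⊞ b ≈[ p ] a′ ⊞ b
⊞-congʳ {p} b e = ⊞-cong e (PSₚ.refl p {b})

opaque
  unfolding _⊗_

  ⊗-head : ∀ a b → (a ⊗ b) 0 ≡ a 0 ℤ.* b 0
  ⊗-head = ⊛-zero

  -- A factor without constant term is divisible by q and gains one order. Each nesting level of
  -- `theta` and `half` gains precision this way.
  ⊗-raise : ∀ x {a b k} → x 0 ≡ + 0 → a ≈[ just k ] b → x ⊗ a ≈[ just (suc k) ] x ⊗ b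
  ⊗-raise x {a} {b} {k} x₀ e = mk λ
    { zero    _       → trans (⊛-zero x a) (trans (vanish (a 0)) (sym (trans (⊛-zero x b) (vanish (b 0)))))
    ; (suc n) (s≤s l) → trans (⊛-suc x a n) (trans (cong₂ ℤ._+_ (trans (vanish (a (suc n))) (sym (vanish (b (suc n)))))
                          (⊛-cong-at (tail x) (tail x) a b n (λ _ _ → refl) (λ i i≤n → at e i (ℕₚ.≤-<-trans i≤n l))))
                          (sym (⊛-suc x b n)))
    }
    where
    vanish : ∀ c → x 0 ℤ.* c ≡ + 0
    vanish c = trans (cong (ℤ._* c) x₀) refl

  qs-⊗ : ∀ a b → qs a ⊗ b ≈ qs (a ⊗ b)
  qs-⊗ a b = pointwise λ
    { zero → ⊛-zero (qs a) b
    ; (suc n) → trans (⊛-suc (qs a) b n) (ℤₚ.+-identityˡ ((a ⊛ b) n)) }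

⊗-head-zero : ∀ x a → x 0 ≡ + 0 → (x ⊗ a) 0 ≡ + 0
⊗-head-zero x a x₀ = trans (⊗-head x a) (cong (ℤ._* a 0) x₀)

qs-cong : ∀ {a b} → a ≈ b → qs a ≈ qs b
qs-cong e = pointwise λ { zero → refl ; (suc n) → at e n tt }

qpow-+ : ∀ m n → qpow (m ℕ.+ n) ≈ qpow m ⊗ qpow n
qpow-+ zero    n = PSR.sym (PSR.*-identityˡ (qpow n))
qpow-+ (suc m) n = PSR.trans (qs-cong (qpow-+ m n)) (PSR.sym (qs-⊗ (qpow m) (qpow n)))

qpow-small : ∀ {m n} → n ℕ.< m → qpow m n ≡ + 0
qpow-small {suc m} {zero}  _       = refl
qpow-small {suc m} {suc n} (s≤s l) = qpow-small l

-- Inverses and infinite products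

-- The list holds the coefficients of the inverse in descending order, so zipping it with ascending
-- indices is a Cauchy product.
inv-conv : ∀ a n → invL a n ≡ map (λ i → inv a (n ℕ.∸ i)) (upTo (suc n))
inv-conv a zero    = refl
inv-conv a (suc n) = cong (inv a (suc n) ∷_) (trans (inv-conv a n)
  (sym (map-upTo-suc (λ i → inv a (suc n ℕ.∸ i)) (suc n))))

zipWith-mapʳ-self : ∀ {A B C : Set} (h : A → B → C) (g : A → B) xs →
  zipWith h xs (map g xs) ≡ map (λ x → h x (g x)) xs
zipWith-mapʳ-self h g []       = refl
zipWith-mapʳ-self h g (x ∷ xs) = cong (h x (g x) ∷_) (zipWith-mapʳ-self h g xs)

inv-suc : ∀ a n → inv a (suc n) ≡ - (tail a ⊛ inv a) n
inv-suc a n = cong (λ l → - sumℤ l) (trans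
  (cong (zipWith (λ j g → a (suc j) ℤ.* g) (upTo (suc n))) (inv-conv a n))
  (zipWith-mapʳ-self (λ j g → a (suc j) ℤ.* g) (λ i → inv a (n ℕ.∸ i)) (upTo (suc n))))

opaque
  unfolding _⊗_

  ⊗-inv : ∀ a → a 0 ≡ + 1 → a ⊗ inv a ≈ 𝟙
  ⊗-inv a a₀ = pointwise λ
    { zero    → trans (⊛-zero a (inv a)) (cong (ℤ._* + 1) a₀)
    ; (suc n) → trans (⊛-suc a (inv a) n) (trans
        (cong (ℤ._+ (tail a ⊛ inv a) n) (trans (cong (ℤ._* inv a (suc n)) a₀) (trans (ℤₚ.*-identityˡ _) (inv-suc a n))))
        (ℤₚ.+-inverseˡ ((tail a ⊛ inv a) n))) }

f⊗f⁻¹ : ∀ m → f m ⊗ f⁻¹ m ≈ 𝟙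
f⊗f⁻¹ m = ⊗-inv (f m) refl

E : ℕ → PS
E j = 𝟙 ⊞ ⊟ qpow j

fp : ℕ → ℕ → PS
fp m zero    = 𝟙
fp m (suc N) = fp m N ⊗ E (m ℕ.* suc N)

opaque
  unfolding _⊗_

  finProd≡fp : ∀ m N → finProd m N ≡ fp m N
  finProd≡fp m zero    = refl
  finProd≡fp m (suc N) = cong (_⊛ E (m ℕ.* suc N)) (finProd≡fp m N)

E→𝟙 : ∀ {j k} → k ℕ.≤ j → E j ≈[ just k ] 𝟙
E→𝟙 {j} k≤j = mk λ n n<k → trans (⊞-at 𝟙 (⊟ qpow j) n) (trans
  (cong (λ z → 𝟙 n ℤ.+ z) (trans (⊟-at (qpow j) n) (cong -_ (qpow-small (ℕₚ.<-≤-trans n<k k≤j)))))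
  (ℤₚ.+-identityʳ (𝟙 n)))

-- The exponent of the new factor is at least N + 1. The index `suc m` matters: at 0 every factor
-- would be 1 - q⁰.
fp-suc : ∀ m N → fp (suc m) (suc N) ≈[ just (suc N) ] fp (suc m) N
fp-suc m N = T.trans
  (⊗-congˡ (fp (suc m) N) (E→𝟙 (ℕₚ.m≤n*m (suc N) (suc m))))
  (T.*-identityʳ (fp (suc m) N))
  where module T = PSₚ (just (suc N))

fp-stable : ∀ m n d → fp (suc m) (d ℕ.+ n) n ≡ fp (suc m) n n
fp-stable m n zero    = refl
fp-stable m n (suc d) = trans
  (at (fp-suc m (d ℕ.+ n)) n (s≤s (ℕₚ.m≤n+m n d)))
  (fp-stable m n d)

-- Coefficient n of f is read off the product of length n, and longer products leave it unchanged.
-- Length N thus serves up to q^N inclusive, whence the bound `suc N`.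
f≈fp : ∀ m {k} N → k ℕ.≤ suc N → f (suc m) ≈[ just k ] fp (suc m) N
f≈fp m N k≤ = mk λ n n<k → trans (cong (λ a → a n) (finProd≡fp (suc m) n))
  (trans (sym (fp-stable m n (N ℕ.∸ n)))
    (cong (λ j → fp (suc m) j n) (ℕₚ.m∸n+n≡m (ℕₚ.≤-pred (ℕₚ.<-≤-trans n<k k≤)))))

-- Theta series

qpow-* : ∀ m k → qpow m ^ᴿ k ≈ qpow (m ℕ.* k)
qpow-* m zero    = pointwise λ n → cong (λ j → qpow j n) (sym (ℕₚ.*-zeroʳ m))
qpow-* m (suc k) = PSR.trans (⊗-congˡ (qpow m) (qpow-* m k)) (PSR.trans (PSR.sym (qpow-+ m (m ℕ.* k)))
  (PSR.reflexive (cong qpow (sym (ℕₚ.*-suc m k)))))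

-- Σ_{n≥0} xⁿ Q^{n(n-1)/2}; the series converges when x has no constant term.
Θ : PS → PS → PS
Θ Q x n = theta Q (suc n) x n

theta-stable : ∀ Q x → x 0 ≡ + 0 → ∀ n → theta Q (suc n) x ≈[ just n ] theta Q n x
theta-stable Q x x₀ zero    = mk λ _ ()
theta-stable Q x x₀ (suc n) = ⊞-congˡ 𝟙
  (⊗-raise x x₀ (theta-stable Q (x ⊗ Q) (⊗-head-zero x Q x₀) n))

theta-stable-+ : ∀ Q x → x 0 ≡ + 0 → ∀ n d → theta Q (d ℕ.+ n) x ≈[ just n ] theta Q n x
theta-stable-+ Q x x₀ n zero    = PSₚ.refl (just n)
theta-stable-+ Q x x₀ n (suc d) = PSₚ.trans (just n)
  (≈-weaken-≤ (ℕₚ.m≤n+m n d) (theta-stable Q x x₀ (d ℕ.+ n)))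
  (theta-stable-+ Q x x₀ n d)

theta→Θ : ∀ Q x → x 0 ≡ + 0 → ∀ {k} n → k ℕ.≤ n → theta Q n x ≈[ just k ] Θ Q x
theta→Θ Q x x₀ n k≤n = mk λ i i<k → let i<n = ℕₚ.<-≤-trans i<k k≤n in
  trans (cong (λ j → theta Q j x i) (sym (ℕₚ.m∸n+n≡m i<n)))
        (at (theta-stable-+ Q x x₀ (suc i) (n ℕ.∸ suc i)) i (ℕₚ.n<1+n i))

-- The Jacobi triple product for power series

module TripleProduct (m : ℕ) where

  Q F : PS
  Q = qpow (suc m)
  F = f (suc m)

  open Gauss Q

  poch≈fp : ∀ n → poch n ≈ fp (suc m) n
  poch≈fp zero    = PSR.refl
  poch≈fp (suc n) = ⊗-cong (poch≈fp n) (⊞-congˡ 𝟙 (⊟-cong (qpow-* (suc m) (suc n))))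

  poch→F : ∀ {k} n → k ℕ.≤ suc n → poch n ≈[ just k ] F
  poch→F {k} n k≤ = T.trans (≈-weaken (just k) (poch≈fp n)) (T.sym (f≈fp m n k≤))
    where module T = PSₚ (just k)

  -- By `gauss-poch` the binomial is a quotient of one Pochhammer product by two others, and all
  -- three tend to F.
  gauss→F⁻¹ : ∀ a b {k} → k ℕ.≤ suc a → k ℕ.≤ suc b → F ⊗ gauss a b ≈[ just k ] 𝟙
  gauss→F⁻¹ a b {k} k≤a k≤b = begin
    F ⊗ gauss a b                       ≈⟨ T.*-identityʳ _ ⟨
    F ⊗ gauss a b ⊗ 𝟙                   ≈⟨ ⊗-congˡ (F ⊗ gauss a b) F⊗F⁻¹ ⟨
    F ⊗ gauss a b ⊗ (F ⊗ f⁻¹ (suc m))   ≈⟨ ≈-weaken p (solve 3 (λ x g y → x :* g :* (x :* y) := g :* (x :* x) :* y)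
                                             PSR.refl F (gauss a b) (f⁻¹ (suc m))) ⟩
    gauss a b ⊗ (F ⊗ F) ⊗ f⁻¹ (suc m)   ≈⟨ ⊗-congʳ (f⁻¹ (suc m)) (⊗-congˡ (gauss a b) (⊗-cong (poch→F a k≤a) (poch→F b k≤b))) ⟨
    gauss a b ⊗ (poch a ⊗ poch b) ⊗ f⁻¹ (suc m) ≈⟨ ⊗-congʳ (f⁻¹ (suc m)) (≈-weaken p (gauss-poch a b)) ⟩
    poch (a ℕ.+ b) ⊗ f⁻¹ (suc m)        ≈⟨ ⊗-congʳ (f⁻¹ (suc m)) (poch→F (a ℕ.+ b) (ℕₚ.≤-trans k≤a (s≤s (ℕₚ.m≤m+n a b)))) ⟩
    F ⊗ f⁻¹ (suc m)                     ≈⟨ F⊗F⁻¹ ⟩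
    𝟙                                   ∎
    where
    p = just k
    module T = PSₚ p
    open SetoidReasoning T.setoid
    F⊗F⁻¹ : F ⊗ f⁻¹ (suc m) ≈[ p ] 𝟙
    F⊗F⁻¹ = ≈-weaken p (f⊗f⁻¹ (suc m))

  -- Each binomial tends to 1/F. The recursion lowers a, and with it the attainable precision, by
  -- one; the factor x restores it.
  half→theta : ∀ a b x → x 0 ≡ + 0 → ∀ {k} → k ℕ.≤ suc a → k ℕ.≤ suc b →
    F ⊗ half a b x ≈[ just k ] theta Q (suc a) x
  half→theta zero b x x₀ {k} k≤a k≤b = T.trans (gauss→F⁻¹ 0 b k≤a k≤b)
    (T.sym (T.trans (⊞-congˡ 𝟙 (T.zeroʳ x)) (T.+-identityʳ 𝟙)))
    where module T = PSₚ (just k)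
  half→theta (suc a) b x x₀ {zero} _ _ = mk λ _ ()
  half→theta (suc a) b x x₀ {suc k} k≤a (s≤s k≤b) = T.trans
    (≈-weaken _ (solve 4 (λ F g x h → F :* (g :+ x :* h) := F :* g :+ x :* (F :* h)) PSR.refl
      F (gauss (suc a) b) x (half a (suc b) (x ⊗ Q))))
    (⊞-cong (gauss→F⁻¹ (suc a) b k≤a (s≤s k≤b))
      (⊗-raise x x₀ (half→theta a (suc b) (x ⊗ Q) (⊗-head-zero x Q x₀)
        (ℕₚ.≤-pred k≤a) (ℕₚ.m≤n⇒m≤1+n (ℕₚ.m≤n⇒m≤1+n k≤b)))))
    where module T = PSₚ (just (suc k))

  half→Θ : ∀ a b x → x 0 ≡ + 0 → ∀ {k} → k ℕ.≤ suc a → k ℕ.≤ suc b → F ⊗ half a b x ≈[ just k ] Θ Q x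
  half→Θ a b x x₀ {k} k≤a k≤b = PSₚ.trans (just k) (half→theta a b x x₀ k≤a k≤b) (theta→Θ Q x x₀ (suc a) k≤a)

  jacobi : ∀ x y → x 0 ≡ + 0 → y 0 ≡ + 0 → x ⊗ y ≈ Q → ∀ N →
    F ⊗ (prod x N ⊗ prod y N) ⊞ 𝟙 ≈[ just N ] Θ Q x ⊞ Θ Q y
  jacobi x y x₀ y₀ xy N = begin
    F ⊗ (prod x N ⊗ prod y N) ⊞ 𝟙
      ≈⟨ ⊞-congˡ (F ⊗ (prod x N ⊗ prod y N)) (T.sym (gauss→F⁻¹ N N (ℕₚ.n≤1+n N) (ℕₚ.n≤1+n N))) ⟩
    F ⊗ (prod x N ⊗ prod y N) ⊞ F ⊗ gauss N N
      ≈⟨ T.sym (T.distribˡ F (prod x N ⊗ prod y N) (gauss N N)) ⟩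
    F ⊗ (prod x N ⊗ prod y N ⊞ gauss N N)
      ≈⟨ ⊗-congˡ F (≈-weaken p (triple-product x y xy N N)) ⟩
    F ⊗ (half N N x ⊞ half N N y)
      ≈⟨ T.distribˡ F (half N N x) (half N N y) ⟩
    F ⊗ half N N x ⊞ F ⊗ half N N y
      ≈⟨ ⊞-cong (half→Θ N N x x₀ (ℕₚ.n≤1+n N) (ℕₚ.n≤1+n N)) (half→Θ N N y y₀ (ℕₚ.n≤1+n N) (ℕₚ.n≤1+n N)) ⟩
    Θ Q x ⊞ Θ Q y ∎
    where
    p = just N
    module T = PSₚ p
    open SetoidReasoning T.setoid

  -- The triple product at x = 1, y = Q, where both halves of the series agree.
  jacobi-Q : ∀ N → F ⊗ (prod Q N ⊗ prod Q N) ≈[ just N ] Θ Q Q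
  -- Both sides arise doubled, because the first factor of `prod 𝟙` is 2; it is cancelled in each
  -- integer coefficient.
  jacobi-Q N = mk λ n n<N → ℤₚ.*-cancelˡ-≡ (+ 2) _ _ (trans (double (F ⊗ (P ⊗ P)) n) (trans (at doubled n n<N) (sym (double (Θ Q Q) n))))
    where
    p = just N
    module T = PSₚ p
    open SetoidReasoning T.setoid
    double : ∀ a n → + 2 ℤ.* a n ≡ (a ⊞ a) n
    double a n = trans (ℤₚ.*-distribʳ-+ (a n) (+ 1) (+ 1))
      (trans (cong₂ ℤ._+_ (ℤₚ.*-identityˡ (a n)) (ℤₚ.*-identityˡ (a n))) (sym (⊞-at a a n)))
    P = prod Q N
    -- For a = N + 1 and b = N the first summand of `half (suc N) N 𝟙` is the binomial added in
    -- `triple-product`, and the two cancel. What is left starts at x = Q, which has no constant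
    -- term, so the limit exists.
    halves : prod 𝟙 (suc N) ⊗ P ≈ half N (suc N) (𝟙 ⊗ Q) ⊞ half N (suc N) Q
    halves = lincomb 𝟙
      (solve 5 (λ r p g h h′ → let :1 = r :^ 0 in
          r :* p :+ :1 :* (g :+ :1 :* h :+ h′) := h :+ h′ :+ :1 :* (r :* p :+ g))
        PSR.refl (prod 𝟙 (suc N)) P (gauss (suc N) N) (half N (suc N) (𝟙 ⊗ Q)) (half N (suc N) Q))
      (triple-product 𝟙 Q (PSR.*-identityˡ Q) (suc N) N)
    prod-𝟙 : prod 𝟙 (suc N) ≈ (𝟙 ⊞ 𝟙) ⊗ P
    prod-𝟙 = PSR.trans (prod-shift 𝟙 N) (⊗-congˡ (𝟙 ⊞ 𝟙) (prod-cong (PSR.*-identityˡ Q) N))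
    half-𝟙Q→Θ : F ⊗ half N (suc N) (𝟙 ⊗ Q) ≈[ p ] Θ Q Q
    half-𝟙Q→Θ = T.trans (half→theta N (suc N) (𝟙 ⊗ Q) (⊗-head 𝟙 Q) N≤ (ℕₚ.m≤n⇒m≤1+n N≤))
      (T.trans (≈-weaken p (theta-cong PSR.refl (PSR.*-identityˡ Q) (suc N))) (theta→Θ Q Q refl (suc N) N≤))
      where N≤ = ℕₚ.n≤1+n N
    doubled : F ⊗ (P ⊗ P) ⊞ F ⊗ (P ⊗ P) ≈[ p ] Θ Q Q ⊞ Θ Q Q
    doubled = begin
      F ⊗ (P ⊗ P) ⊞ F ⊗ (P ⊗ P)
        ≈⟨ ≈-weaken p (solve 2 (λ F P → let :1 = P :^ 0 in
             F :* (P :* P) :+ F :* (P :* P) := F :* ((:1 :+ :1) :* P :* P)) PSR.refl F P) ⟩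
      F ⊗ ((𝟙 ⊞ 𝟙) ⊗ P ⊗ P)
        ≈⟨ ≈-weaken p (⊗-congˡ F (⊗-congʳ P (PSR.sym prod-𝟙))) ⟩
      F ⊗ (prod 𝟙 (suc N) ⊗ P)
        ≈⟨ ≈-weaken p (⊗-congˡ F halves) ⟩
      F ⊗ (half N (suc N) (𝟙 ⊗ Q) ⊞ half N (suc N) Q)
        ≈⟨ T.distribˡ F (half N (suc N) (𝟙 ⊗ Q)) (half N (suc N) Q) ⟩
      F ⊗ half N (suc N) (𝟙 ⊗ Q) ⊞ F ⊗ half N (suc N) Q
        ≈⟨ ⊞-cong half-𝟙Q→Θ (half→Θ N (suc N) Q refl (ℕₚ.n≤1+n N) (ℕₚ.m≤n⇒m≤1+n (ℕₚ.n≤1+n N))) ⟩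
      Θ Q Q ⊞ Θ Q Q ∎

-- Trisection and the norm

-- a(q³)
dil : PS → PS
dil a 0                   = a 0
dil a 1                   = + 0
dil a 2                   = + 0
dil a (suc (suc (suc n))) = dil (tail a) n

dil-cong-at : ∀ {a b} n → (∀ i → i ℕ.≤ n → a i ≡ b i) → dil a n ≡ dil b n
dil-cong-at 0 e = e 0 z≤n
dil-cong-at 1 e = refl
dil-cong-at 2 e = refl
dil-cong-at (suc (suc (suc n))) e = dil-cong-at n λ i i≤n →
  e (suc i) (s≤s (ℕₚ.m≤n⇒m≤1+n (ℕₚ.m≤n⇒m≤1+n i≤n)))

dil-cong : ∀ {p a b} → a ≈[ p ] b → dil a ≈[ p ] dil b
dil-cong {p} e = mk λ n n<p → dil-cong-at n λ i i≤n → at e i (≤-<ᵖ-trans p i≤n n<p)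

opaque
  unfolding _⊗_

  dil-⊞ : ∀ a b → dil (a ⊞ b) ≈ dil a ⊞ dil b
  dil-⊞ a b = pointwise (go a b)
    where
    go : ∀ a b n → dil (a ⊞ b) n ≡ (dil a ⊞ dil b) n
    go a b 0 = refl
    go a b 1 = refl
    go a b 2 = refl
    go a b (suc (suc (suc n))) = go (tail a) (tail b) n

  dil-⊟ : ∀ a → dil (⊟ a) ≈ ⊟ dil a
  dil-⊟ a = pointwise (go a)
    where
    go : ∀ a n → dil (⊟ a) n ≡ (⊟ dil a) n
    go a 0 = refl
    go a 1 = refl
    go a 2 = refl
    go a (suc (suc (suc n))) = go (tail a) n

dil-𝟘 : dil 𝟘 ≈ 𝟘
dil-𝟘 = pointwise go
  where
  go : ∀ n → dil 𝟘 n ≡ + 0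
  go 0 = refl
  go 1 = refl
  go 2 = refl
  go (suc (suc (suc n))) = go n

dil-𝟙 : dil 𝟙 ≈ 𝟙
dil-𝟙 = pointwise λ { 0 → refl ; 1 → refl ; 2 → refl ; (suc (suc (suc n))) → at dil-𝟘 n tt }

opaque
  unfolding _⊗_ dil-⊞

  dil-⊗ : ∀ a b → dil (a ⊗ b) ≈ dil a ⊗ dil b
  dil-⊗ a b = pointwise (go a b)
    where
    dil-· : ∀ c a n → dil (c · a) n ≡ c ℤ.* dil a n
    dil-· c a 0 = refl
    dil-· c a 1 = sym (ℤₚ.*-zeroʳ c)
    dil-· c a 2 = sym (ℤₚ.*-zeroʳ c)
    dil-· c a (suc (suc (suc n))) = dil-· c (tail a) n
    go : ∀ a b n → dil (a ⊛ b) n ≡ (dil a ⊛ dil b) n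
    go a b 0 = trans (⊛-zero a b) (sym (⊛-zero (dil a) (dil b)))
    go a b 1 = sym (trans (⊛-suc (dil a) (dil b) 0)
      (cong₂ ℤ._+_ (ℤₚ.*-zeroʳ (a 0)) (⊛-zero (tail (dil a)) (dil b))))
    go a b 2 = sym (trans (⊛-suc (dil a) (dil b) 1)
      (cong₂ ℤ._+_ (ℤₚ.*-zeroʳ (a 0)) (trans (⊛-suc (tail (dil a)) (dil b) 0)
        (trans (ℤₚ.+-identityˡ _) (⊛-zero (tail (tail (dil a))) (dil b))))))
    go a b (suc (suc (suc n))) = begin
      dil (tail (a ⊛ b)) n
        ≡⟨ dil-cong-at n (λ i _ → ⊛-suc a b i) ⟩
      dil (a 0 · tail b ⊕ tail a ⊛ b) n
        ≡⟨ at (dil-⊞ (a 0 · tail b) (tail a ⊛ b)) n tt ⟩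
      dil (a 0 · tail b) n ℤ.+ dil (tail a ⊛ b) n
        ≡⟨ cong₂ ℤ._+_ (dil-· (a 0) (tail b) n) (go (tail a) b n) ⟩
      a 0 ℤ.* dil (tail b) n ℤ.+ (dil (tail a) ⊛ dil b) n
        ≡⟨ cong (λ z → a 0 ℤ.* dil (tail b) n ℤ.+ z) (sym (trans (⊛-suc (tail (dil a)) (dil b) (suc n))
             (trans (ℤₚ.+-identityˡ _) (trans (⊛-suc (tail (tail (dil a))) (dil b) n) (ℤₚ.+-identityˡ _))))) ⟩
      a 0 ℤ.* dil (tail b) n ℤ.+ (tail (dil a) ⊛ dil b) (suc (suc n))
        ≡⟨ ⊛-suc (dil a) (dil b) (suc (suc n)) ⟨
      (dil a ⊛ dil b) (suc (suc (suc n))) ∎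
      where open ≡-Reasoning

q : PS
q = qpow 1

q⊗≈qs : ∀ a → q ⊗ a ≈ qs a
q⊗≈qs a = PSR.trans (qs-⊗ 𝟙 a) (qs-cong (PSR.*-identityˡ a))

dil-qpow : ∀ n → dil (qpow n) ≈ qpow (3 ℕ.* n)
dil-qpow zero    = dil-𝟙
dil-qpow (suc n) = pointwise λ m → trans (go m) (cong (λ j → qpow j m) (sym (ℕₚ.*-suc 3 n)))
  where
  go : ∀ m → dil (qpow (suc n)) m ≡ qpow (3 ℕ.+ 3 ℕ.* n) m
  go 0 = refl
  go 1 = refl
  go 2 = refl
  go (suc (suc (suc m))) = at (dil-qpow n) m tt

dil-q⊗ : ∀ a → dil (q ⊗ a) ≈ q ^ᴿ 3 ⊗ dil a
dil-q⊗ a = PSR.trans (dil-⊗ q a) (⊗-congʳ (dil a) (PSR.trans (dil-qpow 1) (PSR.sym (qpow-* 1 3))))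

dil-Θ : ∀ Q x → x 0 ≡ + 0 → dil (Θ Q x) ≈ Θ (dil Q) (dil x)
dil-Θ Q x x₀ = ≈-from-truncations λ k → let module T = PSₚ (just k) in T.trans
  (dil-cong (T.sym (theta→Θ Q x x₀ k ℕₚ.≤-refl)))
  (T.trans (≈-weaken (just k) (dil-theta k x)) (theta→Θ (dil Q) (dil x) x₀ k ℕₚ.≤-refl))
  where
  dil-theta : ∀ n x → dil (theta Q n x) ≈ theta (dil Q) n (dil x)
  dil-theta zero    x = dil-𝟘
  dil-theta (suc n) x = PSR.trans (dil-⊞ 𝟙 (x ⊗ theta Q n (x ⊗ Q)))
    (⊞-cong dil-𝟙 (PSR.trans (dil-⊗ x (theta Q n (x ⊗ Q)))
      (⊗-congˡ (dil x) (PSR.trans (dil-theta n (x ⊗ Q)) (theta-cong PSR.refl (dil-⊗ x Q) n)))))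

dil-fp : ∀ m N → dil (fp m N) ≈ fp (3 ℕ.* m) N
dil-fp m zero    = dil-𝟙
dil-fp m (suc N) = PSR.trans (dil-⊗ (fp m N) (E (m ℕ.* suc N)))
  (⊗-cong (dil-fp m N) (PSR.trans (dil-⊞ 𝟙 (⊟ qpow (m ℕ.* suc N)))
    (⊞-cong dil-𝟙 (PSR.trans (dil-⊟ (qpow (m ℕ.* suc N))) (⊟-cong
      (PSR.trans (dil-qpow (m ℕ.* suc N)) (PSR.reflexive (cong qpow (sym (ℕₚ.*-assoc 3 m (suc N)))))))))))

dil-f : ∀ m → dil (f (suc m)) ≈ f (3 ℕ.* suc m)
dil-f m = ≈-from-truncations λ k → let module T = PSₚ (just k) in T.trans
  (dil-cong (f≈fp m k (ℕₚ.n≤1+n k)))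
  (T.trans (≈-weaken (just k) (dil-fp (suc m) k)) (T.sym (f≈fp _ k (ℕₚ.n≤1+n k))))

inverse-unique : ∀ {a b c} → a ⊗ b ≈ 𝟙 → a ⊗ c ≈ 𝟙 → b ≈ c
inverse-unique {a} {b} {c} ab ac = lincomb₂ c (⊟ b)
  (solve 3 (λ a b c → let :1 = a :^ 0 in
    b :+ c :* :1 :+ :- b :* :1 := c :+ c :* (a :* b) :+ :- b :* (a :* c)) PSR.refl a b c) ab ac

dil-f⁻¹ : ∀ m → dil (f⁻¹ (suc m)) ≈ f⁻¹ (3 ℕ.* suc m)
dil-f⁻¹ m = inverse-unique {a = f (3 ℕ.* suc m)}
  (PSR.trans (⊗-congʳ (dil (f⁻¹ (suc m))) (PSR.sym (dil-f m)))
    (PSR.trans (PSR.sym (dil-⊗ (f (suc m)) (f⁻¹ (suc m)))) (PSR.trans (dil-cong (f⊗f⁻¹ (suc m))) dil-𝟙)))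
  (f⊗f⁻¹ (3 ℕ.* suc m))

-- a(q³) + q b(q³) + q² c(q³)
tri : PS → PS → PS → PS
tri a b c 0                   = a 0
tri a b c 1                   = b 0
tri a b c 2                   = c 0
tri a b c (suc (suc (suc n))) = tri (tail a) (tail b) (tail c) n

-- The coefficientwise `tri` lets components be read off; this algebraic form lets the ring solver
-- multiply them.
tri-dil : ∀ a b c → tri a b c ≈ dil a ⊞ q ⊗ dil b ⊞ q ⊗ (q ⊗ dil c)
tri-dil a b c = PSR.trans
  (pointwise λ n → trans (go a b c n) (sym (trans (⊞-at (dil a ⊞ qs (dil b)) (qs (qs (dil c))) n)
    (cong (ℤ._+ qs (qs (dil c)) n) (⊞-at (dil a) (qs (dil b)) n)))))
  (⊞-cong (⊞-congˡ (dil a) (PSR.sym (q⊗≈qs (dil b))))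
    (PSR.sym (PSR.trans (q⊗≈qs (q ⊗ dil c)) (qs-cong (q⊗≈qs (dil c))))))
  where
  shift₂ : ∀ b k → qs (dil (tail b)) k ≡ dil b (2 ℕ.+ k)
  shift₂ b zero    = refl
  shift₂ b (suc k) = refl
  shift₁ : ∀ c k → qs (qs (dil (tail c))) k ≡ dil c (1 ℕ.+ k)
  shift₁ c 0             = refl
  shift₁ c 1             = refl
  shift₁ c (suc (suc k)) = refl
  go : ∀ a b c n → tri a b c n ≡ dil a n ℤ.+ qs (dil b) n ℤ.+ qs (qs (dil c)) n
  go a b c 0 = sym (trans (ℤₚ.+-identityʳ _) (ℤₚ.+-identityʳ _))
  go a b c 1 = sym (trans (ℤₚ.+-identityʳ _) (ℤₚ.+-identityˡ _))
  go a b c 2 = sym (ℤₚ.+-identityˡ _)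
  go a b c (suc (suc (suc n))) = trans (go (tail a) (tail b) (tail c) n)
    (cong₂ ℤ._+_ (cong (λ z → dil (tail a) n ℤ.+ z) (shift₂ b n)) (shift₁ c n))

tri-cong : ∀ {a a′ b b′ c c′} → a ≈ a′ → b ≈ b′ → c ≈ c′ → tri a b c ≈ tri a′ b′ c′
tri-cong ea eb ec = pointwise (go (λ n → at ea n tt) (λ n → at eb n tt) (λ n → at ec n tt))
  where
  go : ∀ {a a′ b b′ c c′} → (∀ n → a n ≡ a′ n) → (∀ n → b n ≡ b′ n) → (∀ n → c n ≡ c′ n) →
       ∀ n → tri a b c n ≡ tri a′ b′ c′ n
  go ea eb ec 0 = ea 0
  go ea eb ec 1 = eb 0
  go ea eb ec 2 = ec 0
  go ea eb ec (suc (suc (suc n))) = go (ea ∘ suc) (eb ∘ suc) (ec ∘ suc) n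

comp : ℕ → PS → PS
comp t a n = a (t ℕ.+ n ℕ.* 3)

tri-comp : ∀ a → tri (comp 0 a) (comp 1 a) (comp 2 a) ≈ a
tri-comp a = pointwise (go a)
  where
  go : ∀ a n → tri (comp 0 a) (comp 1 a) (comp 2 a) n ≡ a n
  go a 0 = refl
  go a 1 = refl
  go a 2 = refl
  go a (suc (suc (suc n))) = go (tail (tail (tail a))) n

comp₀-tri : ∀ a b c → comp 0 (tri a b c) ≈ a
comp₀-tri a b c = pointwise (go a b c)
  where
  go : ∀ a b c n → tri a b c (n ℕ.* 3) ≡ a n
  go a b c zero    = refl
  go a b c (suc n) = go (tail a) (tail b) (tail c) n

comp₁-tri : ∀ a b c → comp 1 (tri a b c) ≈ b
comp₁-tri a b c = pointwise (go a b c)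
  where
  go : ∀ a b c n → tri a b c (1 ℕ.+ n ℕ.* 3) ≡ b n
  go a b c zero    = refl
  go a b c (suc n) = go (tail a) (tail b) (tail c) n

comp₂-tri : ∀ a b c → comp 2 (tri a b c) ≈ c
comp₂-tri a b c = pointwise (go a b c)
  where
  go : ∀ a b c n → tri a b c (2 ℕ.+ n ℕ.* 3) ≡ c n
  go a b c zero    = refl
  go a b c (suc n) = go (tail a) (tail b) (tail c) n

-- Precision 3k is needed: coefficient n < k of a component sits at t + 3n ≤ 3k - 1.
comp-cong : ∀ t {a b} k → t ℕ.≤ 2 → a ≈[ just (k ℕ.* 3) ] b → comp t a ≈[ just k ] comp t b
comp-cong t k t≤2 e = mk λ n n<k → at e _ (ℕₚ.≤-trans (s≤s (ℕₚ.+-monoˡ-≤ (n ℕ.* 3) t≤2)) (ℕₚ.*-monoˡ-≤ 3 n<k))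

-- Multiplication in ℤ[[q]][X]/(X³ - q), with X in the role of q: the q³ produced by a carry is the
-- q of the components.
tri-⊗ : ∀ a b c a′ b′ c′ → tri a b c ⊗ tri a′ b′ c′ ≈
  tri (a ⊗ a′ ⊞ q ⊗ (b ⊗ c′ ⊞ c ⊗ b′)) (a ⊗ b′ ⊞ b ⊗ a′ ⊞ q ⊗ (c ⊗ c′)) (a ⊗ c′ ⊞ b ⊗ b′ ⊞ c ⊗ a′)
tri-⊗ a b c a′ b′ c′ = begin
  tri a b c ⊗ tri a′ b′ c′
    ≈⟨ ⊗-cong (tri-dil a b c) (tri-dil a′ b′ c′) ⟩
  (dil a ⊞ q ⊗ dil b ⊞ q ⊗ (q ⊗ dil c)) ⊗ (dil a′ ⊞ q ⊗ dil b′ ⊞ q ⊗ (q ⊗ dil c′))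
    ≈⟨ solve 7 (λ q a b c a′ b′ c′ →
         (a :+ q :* b :+ q :* (q :* c)) :* (a′ :+ q :* b′ :+ q :* (q :* c′))
      := a :* a′ :+ q :^ 3 :* (b :* c′ :+ c :* b′) :+ q :* (a :* b′ :+ b :* a′ :+ q :^ 3 :* (c :* c′))
         :+ q :* (q :* (a :* c′ :+ b :* b′ :+ c :* a′)))
       PSR.refl q (dil a) (dil b) (dil c) (dil a′) (dil b′) (dil c′) ⟩
  dil a ⊗ dil a′ ⊞ q ^ᴿ 3 ⊗ (dil b ⊗ dil c′ ⊞ dil c ⊗ dil b′)
    ⊞ q ⊗ (dil a ⊗ dil b′ ⊞ dil b ⊗ dil a′ ⊞ q ^ᴿ 3 ⊗ (dil c ⊗ dil c′))
    ⊞ q ⊗ (q ⊗ (dil a ⊗ dil c′ ⊞ dil b ⊗ dil b′ ⊞ dil c ⊗ dil a′))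
    ≈⟨ ⊞-cong (⊞-cong h₀ (⊗-congˡ q h₁)) (⊗-congˡ q (⊗-congˡ q h₂)) ⟨
  dil _ ⊞ q ⊗ dil _ ⊞ q ⊗ (q ⊗ dil _)
    ≈⟨ tri-dil _ _ _ ⟨
  tri (a ⊗ a′ ⊞ q ⊗ (b ⊗ c′ ⊞ c ⊗ b′)) (a ⊗ b′ ⊞ b ⊗ a′ ⊞ q ⊗ (c ⊗ c′)) (a ⊗ c′ ⊞ b ⊗ b′ ⊞ c ⊗ a′) ∎
  where
  open SetoidReasoning PSR.setoid
  dil-⊗⊞⊗ : ∀ a b c d → dil (a ⊗ b ⊞ c ⊗ d) ≈ dil a ⊗ dil b ⊞ dil c ⊗ dil d
  dil-⊗⊞⊗ a b c d = PSR.trans (dil-⊞ (a ⊗ b) (c ⊗ d)) (⊞-cong (dil-⊗ a b) (dil-⊗ c d))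
  h₀ : dil (a ⊗ a′ ⊞ q ⊗ (b ⊗ c′ ⊞ c ⊗ b′)) ≈ dil a ⊗ dil a′ ⊞ q ^ᴿ 3 ⊗ (dil b ⊗ dil c′ ⊞ dil c ⊗ dil b′)
  h₀ = PSR.trans (dil-⊞ (a ⊗ a′) _) (⊞-cong (dil-⊗ a a′)
    (PSR.trans (dil-q⊗ _) (⊗-congˡ (q ^ᴿ 3) (dil-⊗⊞⊗ b c′ c b′))))
  h₁ : dil (a ⊗ b′ ⊞ b ⊗ a′ ⊞ q ⊗ (c ⊗ c′)) ≈ dil a ⊗ dil b′ ⊞ dil b ⊗ dil a′ ⊞ q ^ᴿ 3 ⊗ (dil c ⊗ dil c′)
  h₁ = PSR.trans (dil-⊞ (a ⊗ b′ ⊞ b ⊗ a′) _) (⊞-cong (dil-⊗⊞⊗ a b′ b a′)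
    (PSR.trans (dil-q⊗ _) (⊗-congˡ (q ^ᴿ 3) (dil-⊗ c c′))))
  h₂ : dil (a ⊗ c′ ⊞ b ⊗ b′ ⊞ c ⊗ a′) ≈ dil a ⊗ dil c′ ⊞ dil b ⊗ dil b′ ⊞ dil c ⊗ dil a′
  h₂ = PSR.trans (dil-⊞ (a ⊗ c′ ⊞ b ⊗ b′) _) (⊞-cong (dil-⊗⊞⊗ a c′ b b′) (dil-⊗ c a′))

-- The norm of a series and of the products f

-- Evaluated at q³ this is the product of a(ζq) over the cube roots of unity ζ.
Norm : PS → PS
Norm a = norm q (comp 0 a) (comp 1 a) (comp 2 a)

Norm-cong : ∀ {a b} → a ≈ b → Norm a ≈ Norm b
Norm-cong {a} {b} e = norm-cong q (c 0) (c 1) (c 2)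
  where
  c : ∀ t → comp t a ≈ comp t b
  c t = pointwise λ n → at e (t ℕ.+ n ℕ.* 3) tt

Norm-cong-truncated : ∀ {a b} k → a ≈[ just (k ℕ.* 3) ] b → Norm a ≈[ just k ] Norm b
Norm-cong-truncated k e = RingIdentities.norm-cong (psRing (just k)) (constHom (just k)) q
  (comp-cong 0 k z≤n e) (comp-cong 1 k (s≤s z≤n) e) (comp-cong 2 k (s≤s (s≤s z≤n)) e)

Norm-tri : ∀ a b c → Norm (tri a b c) ≈ norm q a b c
Norm-tri a b c = norm-cong q (comp₀-tri a b c) (comp₁-tri a b c) (comp₂-tri a b c)

Norm-⊗ : ∀ a b → Norm (a ⊗ b) ≈ Norm a ⊗ Norm b
Norm-⊗ a b = begin
  Norm (a ⊗ b)
    ≈⟨ Norm-cong (PSR.trans (⊗-cong (PSR.sym (tri-comp a)) (PSR.sym (tri-comp b))) (tri-⊗ a₀ a₁ a₂ b₀ b₁ b₂)) ⟩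
  Norm (tri (a₀ ⊗ b₀ ⊞ q ⊗ (a₁ ⊗ b₂ ⊞ a₂ ⊗ b₁)) (a₀ ⊗ b₁ ⊞ a₁ ⊗ b₀ ⊞ q ⊗ (a₂ ⊗ b₂)) (a₀ ⊗ b₂ ⊞ a₁ ⊗ b₁ ⊞ a₂ ⊗ b₀))
    ≈⟨ Norm-tri (a₀ ⊗ b₀ ⊞ q ⊗ (a₁ ⊗ b₂ ⊞ a₂ ⊗ b₁)) (a₀ ⊗ b₁ ⊞ a₁ ⊗ b₀ ⊞ q ⊗ (a₂ ⊗ b₂)) (a₀ ⊗ b₂ ⊞ a₁ ⊗ b₁ ⊞ a₂ ⊗ b₀) ⟩
  norm q (a₀ ⊗ b₀ ⊞ q ⊗ (a₁ ⊗ b₂ ⊞ a₂ ⊗ b₁)) (a₀ ⊗ b₁ ⊞ a₁ ⊗ b₀ ⊞ q ⊗ (a₂ ⊗ b₂)) (a₀ ⊗ b₂ ⊞ a₁ ⊗ b₁ ⊞ a₂ ⊗ b₀)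
    ≈⟨ norm-* q a₀ a₁ a₂ b₀ b₁ b₂ ⟩
  Norm a ⊗ Norm b ∎
  where
  open SetoidReasoning PSR.setoid
  a₀ a₁ a₂ b₀ b₁ b₂ : PS
  a₀ = comp 0 a
  a₁ = comp 1 a
  a₂ = comp 2 a
  b₀ = comp 0 b
  b₁ = comp 1 b
  b₂ = comp 2 b

cube : PS → PS
cube a = a ⊗ a ⊗ a

E-≡ : ∀ {i j} → i ≡ j → E i ≈ E j
E-≡ e = PSR.reflexive (cong E e)

q⊗qpow : ∀ n → q ⊗ qpow n ≈ qpow (suc n)
q⊗qpow n = q⊗≈qs (qpow n)

qpow-cubed : ∀ i → cube (qpow i) ≈ qpow (i ℕ.* 3)
qpow-cubed i = PSR.trans (solve 1 (λ x → x :* x :* x := x :^ 3) PSR.refl (qpow i)) (qpow-* i 3)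

dil-qpow′ : ∀ i → dil (qpow i) ≈ qpow (i ℕ.* 3)
dil-qpow′ i = PSR.trans (dil-qpow i) (PSR.reflexive (cong qpow (ℕₚ.*-comm 3 i)))

dil-⊟qpow : ∀ i → dil (⊟ qpow i) ≈ ⊟ qpow (i ℕ.* 3)
dil-⊟qpow i = PSR.trans (dil-⊟ (qpow i)) (⊟-cong (dil-qpow′ i))

dil-𝟘′ : dil 𝟘 ≈ q ⊞ ⊟ q
dil-𝟘′ = PSR.trans dil-𝟘 (0≈x-x q)

-- A series in q³ coincides with its conjugates, so its norm is a cube.
Norm-E₀ : ∀ i → Norm (E (i ℕ.* 3)) ≈ cube (E i)
Norm-E₀ i = begin
  Norm (E (i ℕ.* 3))       ≈⟨ Norm-cong split ⟩
  Norm (tri (E i) 𝟘 𝟘)     ≈⟨ Norm-tri (E i) 𝟘 𝟘 ⟩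
  norm q (E i) 𝟘 𝟘      ≈⟨ norm-scalar q (E i) ⟩
  cube (E i)            ∎
  where
  open SetoidReasoning PSR.setoid
  split : E (i ℕ.* 3) ≈ tri (E i) 𝟘 𝟘
  split = PSR.sym (PSR.trans (tri-dil (E i) 𝟘 𝟘) (PSR.trans
    (⊞-cong (⊞-cong (PSR.trans (dil-⊞ 𝟙 (⊟ qpow i)) (⊞-cong dil-𝟙 (dil-⊟qpow i))) (⊗-congˡ q dil-𝟘))
      (⊗-congˡ q (⊗-congˡ q dil-𝟘)))
    (PSR.trans (⊞-cong (⊞-cong (PSR.refl {E (i ℕ.* 3)}) (PSR.zeroʳ q)) (PSR.trans (⊗-congˡ q (PSR.zeroʳ q)) (PSR.zeroʳ q)))
      (PSR.trans (PSR.+-identityʳ _) (PSR.+-identityʳ _)))))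

-- For j prime to 3 the product of 1 - ζqʲ over the cube roots of unity is 1 - q³ʲ, that is, 1 - qʲ
-- read in the variable q³.
Norm-E₁ : ∀ i → Norm (E (1 ℕ.+ i ℕ.* 3)) ≈ E (1 ℕ.+ i ℕ.* 3)
Norm-E₁ i = begin
  Norm (E (1 ℕ.+ i ℕ.* 3))     ≈⟨ Norm-cong split ⟩
  Norm (tri 𝟙 (⊟ qpow i) 𝟘)    ≈⟨ Norm-tri 𝟙 (⊟ qpow i) 𝟘 ⟩
  norm q 𝟙 (⊟ qpow i) 𝟘     ≈⟨ norm-1-X q (qpow i) ⟩
  𝟙 ⊞ ⊟ (q ⊗ cube (qpow i))     ≈⟨ ⊞-congˡ 𝟙 (⊟-cong (PSR.trans (⊗-congˡ q (qpow-cubed i)) (q⊗qpow (i ℕ.* 3)))) ⟩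
  E (1 ℕ.+ i ℕ.* 3)         ∎
  where
  open SetoidReasoning PSR.setoid
  split : E (1 ℕ.+ i ℕ.* 3) ≈ tri 𝟙 (⊟ qpow i) 𝟘
  split = PSR.sym (PSR.trans (tri-dil 𝟙 (⊟ qpow i) 𝟘) (PSR.trans
    (⊞-cong (⊞-cong dil-𝟙 (⊗-congˡ q (dil-⊟qpow i))) (⊗-congˡ q (⊗-congˡ q dil-𝟘′)))
    (PSR.trans (solve 2 (λ q w → let :1 = q :^ 0 ; :0 = q :- q in
        :1 :+ q :* :- w :+ q :* (q :* :0) := :1 :- q :* w) PSR.refl q (qpow (i ℕ.* 3)))
      (⊞-congˡ 𝟙 (⊟-cong (q⊗qpow (i ℕ.* 3)))))))

Norm-E₂ : ∀ i → Norm (E (2 ℕ.+ i ℕ.* 3)) ≈ E (2 ℕ.+ i ℕ.* 3)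
Norm-E₂ i = begin
  Norm (E (2 ℕ.+ i ℕ.* 3))     ≈⟨ Norm-cong split ⟩
  Norm (tri 𝟙 𝟘 (⊟ qpow i))    ≈⟨ Norm-tri 𝟙 𝟘 (⊟ qpow i) ⟩
  norm q 𝟙 𝟘 (⊟ qpow i)     ≈⟨ norm-1-X² q (qpow i) ⟩
  𝟙 ⊞ ⊟ (q ⊗ (q ⊗ cube (qpow i))) ≈⟨ ⊞-congˡ 𝟙 (⊟-cong (PSR.trans (⊗-congˡ q (⊗-congˡ q (qpow-cubed i))) (q²⊗qpow (i ℕ.* 3)))) ⟩
  E (2 ℕ.+ i ℕ.* 3)         ∎
  where
  open SetoidReasoning PSR.setoid
  q²⊗qpow : ∀ n → q ⊗ (q ⊗ qpow n) ≈ qpow (2 ℕ.+ n)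
  q²⊗qpow n = PSR.trans (⊗-congˡ q (q⊗qpow n)) (q⊗qpow (suc n))
  split : E (2 ℕ.+ i ℕ.* 3) ≈ tri 𝟙 𝟘 (⊟ qpow i)
  split = PSR.sym (PSR.trans (tri-dil 𝟙 𝟘 (⊟ qpow i)) (PSR.trans
    (⊞-cong (⊞-cong dil-𝟙 (⊗-congˡ q dil-𝟘′)) (⊗-congˡ q (⊗-congˡ q (dil-⊟qpow i))))
    (PSR.trans (solve 2 (λ q w → let :1 = q :^ 0 ; :0 = q :- q in
        :1 :+ q :* :0 :+ q :* (q :* :- w) := :1 :- q :* (q :* w)) PSR.refl q (qpow (i ℕ.* 3)))
      (⊞-congˡ 𝟙 (⊟-cong (q²⊗qpow (i ℕ.* 3)))))))

Norm-E : ∀ {j} i t → j ≡ t ℕ.+ i ℕ.* 3 → t ≡ 1 ⊎ t ≡ 2 → Norm (E j) ≈ E j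
Norm-E i t refl (inj₁ refl) = Norm-E₁ i
Norm-E i t refl (inj₂ refl) = Norm-E₂ i

-- For m prime to 3, which the hypotheses express, the factors with index prime to 3 are fixed and
-- those with index 3k contribute (1 - q^(mk))³. The indices up to 3n divisible by 3 make up
-- `fp (3 ℕ.* m) n`, which explains the two lengths.
Norm-fp : ∀ m → (∀ n → Norm (E (m ℕ.* (1 ℕ.+ n ℕ.* 3))) ≈ E (m ℕ.* (1 ℕ.+ n ℕ.* 3))) →
  (∀ n → Norm (E (m ℕ.* (2 ℕ.+ n ℕ.* 3))) ≈ E (m ℕ.* (2 ℕ.+ n ℕ.* 3))) →
  ∀ n → Norm (fp m (n ℕ.* 3)) ⊗ fp (3 ℕ.* m) n ≈ fp m (n ℕ.* 3) ⊗ cube (fp m n)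
Norm-fp m n₁ n₂ zero = PSR.trans (⊗-congʳ 𝟙 Norm-𝟙)
  (solve 1 (λ x → let :1 = x :^ 0 in :1 :* :1 := :1 :* (:1 :* :1 :* :1)) PSR.refl q)
  where
  Norm-𝟙 : Norm 𝟙 ≈ 𝟙
  Norm-𝟙 = PSR.trans (norm-cong q comp₀ comp₁ comp₂)
    (PSR.trans (norm-scalar q 𝟙) (solve 1 (λ q → let :1 = q :^ 0 in :1 :* :1 :* :1 := :1) PSR.refl q))
    where
    comp₀ : comp 0 𝟙 ≈ 𝟙
    comp₀ = pointwise λ { zero → refl ; (suc n) → refl }
    comp₁ : comp 1 𝟙 ≈ 𝟘
    comp₁ = pointwise λ _ → refl
    comp₂ : comp 2 𝟙 ≈ 𝟘
    comp₂ = pointwise λ _ → refl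
Norm-fp m n₁ n₂ (suc n) = begin
  Norm (P ⊗ a ⊗ b ⊗ c) ⊗ (R ⊗ E (3 ℕ.* m ℕ.* suc n))
    ≈⟨ ⊗-cong Norm-step (⊗-congˡ R (E-≡ e₃)) ⟩
  Norm P ⊗ a ⊗ b ⊗ cube d ⊗ (R ⊗ c)
    ≈⟨ solveᴹ 6 (λ p a b d r c → p ∙ a ∙ b ∙ (d ∙ d ∙ d) ∙ (r ∙ c) ≜ p ∙ r ∙ (a ∙ b ∙ c ∙ (d ∙ d ∙ d)))
         PSR.refl (Norm P) a b d R c ⟩
  Norm P ⊗ R ⊗ (a ⊗ b ⊗ c ⊗ cube d)
    ≈⟨ ⊗-congʳ (a ⊗ b ⊗ c ⊗ cube d) (Norm-fp m n₁ n₂ n) ⟩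
  P ⊗ cube S ⊗ (a ⊗ b ⊗ c ⊗ cube d)
    ≈⟨ solveᴹ 6 (λ p a b d s c → p ∙ (s ∙ s ∙ s) ∙ (a ∙ b ∙ c ∙ (d ∙ d ∙ d))
                  ≜ p ∙ a ∙ b ∙ c ∙ ((s ∙ d) ∙ (s ∙ d) ∙ (s ∙ d)))
         PSR.refl P a b d S c ⟩
  P ⊗ a ⊗ b ⊗ c ⊗ cube (S ⊗ d) ∎
  where
  open SetoidReasoning PSR.setoid
  P R S a b c d : PS
  P = fp m (n ℕ.* 3)
  R = fp (3 ℕ.* m) n
  S = fp m n
  a = E (m ℕ.* (1 ℕ.+ n ℕ.* 3))
  b = E (m ℕ.* (2 ℕ.+ n ℕ.* 3))
  c = E (m ℕ.* (3 ℕ.+ n ℕ.* 3))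
  d = E (m ℕ.* suc n)
  e₀ : m ℕ.* (3 ℕ.+ n ℕ.* 3) ≡ m ℕ.* suc n ℕ.* 3
  e₀ = sym (ℕₚ.*-assoc m (suc n) 3)
  e₃ : 3 ℕ.* m ℕ.* suc n ≡ m ℕ.* (3 ℕ.+ n ℕ.* 3)
  e₃ = sym (trans e₀ (trans (ℕₚ.*-comm (m ℕ.* suc n) 3) (sym (ℕₚ.*-assoc 3 m (suc n)))))
  Norm-step : Norm (P ⊗ a ⊗ b ⊗ c) ≈ Norm P ⊗ a ⊗ b ⊗ cube d
  Norm-step = PSR.trans (Norm-⊗ (P ⊗ a ⊗ b) c) (⊗-cong
    (PSR.trans (Norm-⊗ (P ⊗ a) b) (⊗-cong (PSR.trans (Norm-⊗ P a) (⊗-congˡ (Norm P) (n₁ n))) (n₂ n)))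
    (PSR.trans (Norm-cong (E-≡ e₀)) (Norm-E₀ (m ℕ.* suc n))))

Norm-f : ∀ m → (∀ n → Norm (E (suc m ℕ.* (1 ℕ.+ n ℕ.* 3))) ≈ E (suc m ℕ.* (1 ℕ.+ n ℕ.* 3))) →
  (∀ n → Norm (E (suc m ℕ.* (2 ℕ.+ n ℕ.* 3))) ≈ E (suc m ℕ.* (2 ℕ.+ n ℕ.* 3))) →
  Norm (f (suc m)) ⊗ f (3 ℕ.* suc m) ≈ f (suc m) ⊗ cube (f (suc m))
Norm-f m n₁ n₂ = ≈-from-truncations λ k →
  let module T = PSₚ (just k)
      F = fp (suc m)
      3k : F (k ℕ.* 3) ≈[ just k ] f (suc m)
      3k = T.sym (f≈fp m (k ℕ.* 3) (ℕₚ.m≤n⇒m≤1+n (ℕₚ.m≤m*n k 3)))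
      1k : F k ≈[ just k ] f (suc m)
      1k = T.sym (f≈fp m k (ℕₚ.n≤1+n k))
  in T.trans
    (⊗-cong (Norm-cong-truncated k (f≈fp m (k ℕ.* 3) (ℕₚ.n≤1+n _))) (f≈fp _ k (ℕₚ.n≤1+n k)))
    (T.trans (≈-weaken (just k) (Norm-fp (suc m) n₁ n₂ k))
      (⊗-cong 3k (⊗-cong (⊗-cong 1k 1k) 1k)))

Norm-f₁ : Norm (f 1) ⊗ f 3 ≈ f 1 ⊗ cube (f 1)
Norm-f₁ = Norm-f 0 (λ n → Norm-E n 1 (ℕₚ.*-identityˡ _) (inj₁ refl)) (λ n → Norm-E n 2 (ℕₚ.*-identityˡ _) (inj₂ refl))

-- Multiplication by 2 exchanges the residues 1 and 2 modulo 3.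
Norm-f₂ : Norm (f 2) ⊗ f 6 ≈ f 2 ⊗ cube (f 2)
Norm-f₂ = Norm-f 1 (λ n → Norm-E (2 ℕ.* n) 2 (e₁ n) (inj₂ refl)) (λ n → Norm-E (1 ℕ.+ 2 ℕ.* n) 1 (e₂ n) (inj₁ refl))
  where
  e₁ : ∀ n → 2 ℕ.* (1 ℕ.+ n ℕ.* 3) ≡ 2 ℕ.+ 2 ℕ.* n ℕ.* 3
  e₁ = ℕSolver.solve-∀
  e₂ : ∀ n → 2 ℕ.* (2 ℕ.+ n ℕ.* 3) ≡ 1 ℕ.+ (1 ℕ.+ 2 ℕ.* n) ℕ.* 3
  e₂ = ℕSolver.solve-∀

-- Finite products behind the theta quotients

E⁺ : ℕ → PS
E⁺ j = 𝟙 ⊞ qpow j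

qpow-progression : ∀ r m n {j} → j ≡ r ℕ.+ m ℕ.* n → qpow r ⊗ qpow m ^ᴿ n ≈ qpow j
qpow-progression r m n refl = PSR.trans (⊗-congˡ (qpow r) (qpow-* m n)) (PSR.sym (qpow-+ r (m ℕ.* n)))

factor⁺ : ∀ r m n {j} → j ≡ r ℕ.+ m ℕ.* n → 𝟙 ⊞ qpow r ⊗ qpow m ^ᴿ n ≈ E⁺ j
factor⁺ r m n e = ⊞-congˡ 𝟙 (qpow-progression r m n e)

factor⁻ : ∀ r m n {j} → j ≡ r ℕ.+ m ℕ.* n → 𝟙 ⊞ (⊟ qpow r) ⊗ qpow m ^ᴿ n ≈ E j
factor⁻ r m n e = ⊞-congˡ 𝟙 (PSR.trans
  (solve 2 (λ x y → :- x :* y := :- (x :* y)) PSR.refl (qpow r) (qpow m ^ᴿ n))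
  (⊟-cong (qpow-progression r m n e)))

E⁺⊗E : ∀ j {k} → k ≡ j ℕ.+ j → E⁺ j ⊗ E j ≈ E k
E⁺⊗E j refl = PSR.trans
  (solve 1 (λ x → let :1 = x :^ 0 in (:1 :+ x) :* (:1 :- x) := :1 :- x :* x) PSR.refl (qpow j))
  (⊞-congˡ 𝟙 (⊟-cong (PSR.sym (qpow-+ j j))))

prod₁ : ∀ n → Gauss.prod (qpow 2) (⊟ qpow 1) n ⊗ fp 2 n ≈ fp 1 (n ℕ.* 2)
prod₁ zero    = PSR.*-identityˡ 𝟙
prod₁ (suc n) = begin
  P ⊗ (𝟙 ⊞ (⊟ qpow 1) ⊗ qpow 2 ^ᴿ n) ⊗ (S ⊗ E (2 ℕ.* suc n))
    ≈⟨ ⊗-cong (⊗-congˡ P (factor⁻ 1 2 n (e₁ n))) (⊗-congˡ S (E-≡ (e₂ n))) ⟩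
  P ⊗ a ⊗ (S ⊗ b)
    ≈⟨ solveᴹ 4 (λ p a s b → p ∙ a ∙ (s ∙ b) ≜ p ∙ s ∙ a ∙ b) PSR.refl P a S b ⟩
  P ⊗ S ⊗ a ⊗ b
    ≈⟨ ⊗-congʳ b (⊗-congʳ a (prod₁ n)) ⟩
  fp 1 (n ℕ.* 2) ⊗ a ⊗ b ∎
  where
  open SetoidReasoning PSR.setoid
  P S a b : PS
  P = Gauss.prod (qpow 2) (⊟ qpow 1) n
  S = fp 2 n
  a = E (1 ℕ.* (1 ℕ.+ n ℕ.* 2))
  b = E (1 ℕ.* (2 ℕ.+ n ℕ.* 2))
  e₁ : ∀ n → 1 ℕ.* (1 ℕ.+ n ℕ.* 2) ≡ 1 ℕ.+ 2 ℕ.* n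
  e₁ = ℕSolver.solve-∀
  e₂ : ∀ n → 2 ℕ.* (1 ℕ.+ n) ≡ 1 ℕ.* (2 ℕ.+ n ℕ.* 2)
  e₂ = ℕSolver.solve-∀

prod₂ : ∀ n → Gauss.prod (qpow 1) (qpow 1) n ⊗ fp 1 n ≈ fp 2 n
prod₂ zero    = PSR.*-identityˡ 𝟙
prod₂ (suc n) = begin
  P ⊗ (𝟙 ⊞ qpow 1 ⊗ qpow 1 ^ᴿ n) ⊗ (S ⊗ a)
    ≈⟨ ⊗-congʳ (S ⊗ a) (⊗-congˡ P (factor⁺ 1 1 n (e₁ n))) ⟩
  P ⊗ a⁺ ⊗ (S ⊗ a)
    ≈⟨ solveᴹ 4 (λ p a⁺ s a → p ∙ a⁺ ∙ (s ∙ a) ≜ p ∙ s ∙ (a⁺ ∙ a)) PSR.refl P a⁺ S a ⟩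
  P ⊗ S ⊗ (a⁺ ⊗ a)
    ≈⟨ ⊗-cong (prod₂ n) (E⁺⊗E (1 ℕ.* suc n) (e₂ n)) ⟩
  fp 2 n ⊗ E (2 ℕ.* suc n) ∎
  where
  open SetoidReasoning PSR.setoid
  P S a a⁺ : PS
  P = Gauss.prod (qpow 1) (qpow 1) n
  S = fp 1 n
  a = E (1 ℕ.* suc n)
  a⁺ = E⁺ (1 ℕ.* suc n)
  e₁ : ∀ n → 1 ℕ.* (1 ℕ.+ n) ≡ 1 ℕ.+ 1 ℕ.* n
  e₁ = ℕSolver.solve-∀
  e₂ : ∀ n → 2 ℕ.* (1 ℕ.+ n) ≡ 1 ℕ.* (1 ℕ.+ n) ℕ.+ 1 ℕ.* (1 ℕ.+ n)
  e₂ = ℕSolver.solve-∀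

-- A sieve: the exponents ±1 modulo 6 are all exponents, without the multiples of 2 and of 3, with
-- those of 6 restored. The lengths 6n, 3n, 2n, n all reach exponent 6n.
prod₃ : ∀ n → Gauss.prod (qpow 6) (⊟ qpow 1) n ⊗ Gauss.prod (qpow 6) (⊟ qpow 5) n
  ⊗ (fp 2 (n ℕ.* 3) ⊗ fp 3 (n ℕ.* 2)) ≈ fp 1 (n ℕ.* 6) ⊗ fp 6 n
prod₃ zero    = solve 1 (λ x → let :1 = x :^ 0 in :1 :* :1 :* (:1 :* :1) := :1 :* :1) PSR.refl q
prod₃ (suc n) = begin
  P ⊗ (𝟙 ⊞ (⊟ qpow 1) ⊗ qpow 6 ^ᴿ n) ⊗ (P′ ⊗ (𝟙 ⊞ (⊟ qpow 5) ⊗ qpow 6 ^ᴿ n))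
    ⊗ (S ⊗ E (2 ℕ.* (1 ℕ.+ n ℕ.* 3)) ⊗ E (2 ℕ.* (2 ℕ.+ n ℕ.* 3)) ⊗ E (2 ℕ.* (3 ℕ.+ n ℕ.* 3))
       ⊗ (S′ ⊗ E (3 ℕ.* (1 ℕ.+ n ℕ.* 2)) ⊗ E (3 ℕ.* (2 ℕ.+ n ℕ.* 2))))
    ≈⟨ ⊗-cong (⊗-cong (⊗-congˡ P (factor⁻ 1 6 n (e₁ n))) (⊗-congˡ P′ (factor⁻ 5 6 n (e₅ n))))
         (⊗-cong (⊗-cong (⊗-cong (⊗-congˡ S (E-≡ (e₂ n))) (E-≡ (e₄ n))) (E-≡ (e₆ n)))
                 (⊗-cong (⊗-congˡ S′ (E-≡ (e₃ n))) (E-≡ (e₆′ n)))) ⟩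
  P ⊗ x 1 ⊗ (P′ ⊗ x 5) ⊗ (S ⊗ x 2 ⊗ x 4 ⊗ x 6 ⊗ (S′ ⊗ x 3 ⊗ y))
    ≈⟨ solveᴹ 11 (λ p p′ s s′ x₁ x₂ x₃ x₄ x₅ x₆ y →
         p ∙ x₁ ∙ (p′ ∙ x₅) ∙ (s ∙ x₂ ∙ x₄ ∙ x₆ ∙ (s′ ∙ x₃ ∙ y))
         ≜ p ∙ p′ ∙ (s ∙ s′) ∙ (x₁ ∙ x₂ ∙ x₃ ∙ x₄ ∙ x₅ ∙ x₆ ∙ y))
         PSR.refl P P′ S S′ (x 1) (x 2) (x 3) (x 4) (x 5) (x 6) y ⟩
  P ⊗ P′ ⊗ (S ⊗ S′) ⊗ (x 1 ⊗ x 2 ⊗ x 3 ⊗ x 4 ⊗ x 5 ⊗ x 6 ⊗ y)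
    ≈⟨ ⊗-congʳ (x 1 ⊗ x 2 ⊗ x 3 ⊗ x 4 ⊗ x 5 ⊗ x 6 ⊗ y) (prod₃ n) ⟩
  M ⊗ M′ ⊗ (x 1 ⊗ x 2 ⊗ x 3 ⊗ x 4 ⊗ x 5 ⊗ x 6 ⊗ y)
    ≈⟨ solveᴹ 9 (λ m m′ x₁ x₂ x₃ x₄ x₅ x₆ y →
         m ∙ m′ ∙ (x₁ ∙ x₂ ∙ x₃ ∙ x₄ ∙ x₅ ∙ x₆ ∙ y)
         ≜ m ∙ x₁ ∙ x₂ ∙ x₃ ∙ x₄ ∙ x₅ ∙ x₆ ∙ (m′ ∙ y))
         PSR.refl M M′ (x 1) (x 2) (x 3) (x 4) (x 5) (x 6) y ⟩
  M ⊗ x 1 ⊗ x 2 ⊗ x 3 ⊗ x 4 ⊗ x 5 ⊗ x 6 ⊗ (M′ ⊗ y) ∎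
  where
  open SetoidReasoning PSR.setoid
  P P′ S S′ M M′ y : PS
  P = Gauss.prod (qpow 6) (⊟ qpow 1) n
  P′ = Gauss.prod (qpow 6) (⊟ qpow 5) n
  S = fp 2 (n ℕ.* 3)
  S′ = fp 3 (n ℕ.* 2)
  M = fp 1 (n ℕ.* 6)
  M′ = fp 6 n
  y = E (6 ℕ.* suc n)
  x : ℕ → PS
  x i = E (1 ℕ.* (i ℕ.+ n ℕ.* 6))
  e₁ : ∀ n → 1 ℕ.* (1 ℕ.+ n ℕ.* 6) ≡ 1 ℕ.+ 6 ℕ.* n
  e₁ = ℕSolver.solve-∀
  e₅ : ∀ n → 1 ℕ.* (5 ℕ.+ n ℕ.* 6) ≡ 5 ℕ.+ 6 ℕ.* n
  e₅ = ℕSolver.solve-∀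
  e₂ : ∀ n → 2 ℕ.* (1 ℕ.+ n ℕ.* 3) ≡ 1 ℕ.* (2 ℕ.+ n ℕ.* 6)
  e₂ = ℕSolver.solve-∀
  e₄ : ∀ n → 2 ℕ.* (2 ℕ.+ n ℕ.* 3) ≡ 1 ℕ.* (4 ℕ.+ n ℕ.* 6)
  e₄ = ℕSolver.solve-∀
  e₆ : ∀ n → 2 ℕ.* (3 ℕ.+ n ℕ.* 3) ≡ 1 ℕ.* (6 ℕ.+ n ℕ.* 6)
  e₆ = ℕSolver.solve-∀
  e₃ : ∀ n → 3 ℕ.* (1 ℕ.+ n ℕ.* 2) ≡ 1 ℕ.* (3 ℕ.+ n ℕ.* 6)
  e₃ = ℕSolver.solve-∀
  e₆′ : ∀ n → 3 ℕ.* (2 ℕ.+ n ℕ.* 2) ≡ 6 ℕ.* (1 ℕ.+ n)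
  e₆′ = ℕSolver.solve-∀

-- (1 + qʲ)(1 - qʲ) = 1 - q²ʲ for j prime to 3; the multiples of 3 are balanced by `fp 3 n` and
-- `fp 6 n`.
prod₄ : ∀ n → Gauss.prod (qpow 3) (qpow 1) n ⊗ Gauss.prod (qpow 3) (qpow 2) n
  ⊗ (fp 6 n ⊗ fp 1 (n ℕ.* 3)) ≈ fp 2 (n ℕ.* 3) ⊗ fp 3 n
prod₄ zero    = solve 1 (λ x → let :1 = x :^ 0 in :1 :* :1 :* (:1 :* :1) := :1 :* :1) PSR.refl q
prod₄ (suc n) = begin
  P ⊗ (𝟙 ⊞ qpow 1 ⊗ qpow 3 ^ᴿ n) ⊗ (P′ ⊗ (𝟙 ⊞ qpow 2 ⊗ qpow 3 ^ᴿ n))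
    ⊗ (S ⊗ E (6 ℕ.* suc n) ⊗ (S′ ⊗ x 1 ⊗ x 2 ⊗ x 3))
    ≈⟨ ⊗-cong (⊗-cong (⊗-congˡ P (factor⁺ 1 3 n (e₁ n))) (⊗-congˡ P′ (factor⁺ 2 3 n (e₂ n))))
         (⊗-cong (⊗-congˡ S (E-≡ (e₆ n))) (⊗-congˡ (S′ ⊗ x 1 ⊗ x 2) (E-≡ (e₃ n)))) ⟩
  P ⊗ x⁺ 1 ⊗ (P′ ⊗ x⁺ 2) ⊗ (S ⊗ y 3 ⊗ (S′ ⊗ x 1 ⊗ x 2 ⊗ z))
    ≈⟨ solveᴹ 10 (λ p p′ s s′ x₁⁺ x₂⁺ x₁ x₂ y₃ z →
         p ∙ x₁⁺ ∙ (p′ ∙ x₂⁺) ∙ (s ∙ y₃ ∙ (s′ ∙ x₁ ∙ x₂ ∙ z))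
         ≜ p ∙ p′ ∙ (s ∙ s′) ∙ (x₁⁺ ∙ x₁ ∙ (x₂⁺ ∙ x₂) ∙ (y₃ ∙ z)))
         PSR.refl P P′ S S′ (x⁺ 1) (x⁺ 2) (x 1) (x 2) (y 3) z ⟩
  P ⊗ P′ ⊗ (S ⊗ S′) ⊗ (x⁺ 1 ⊗ x 1 ⊗ (x⁺ 2 ⊗ x 2) ⊗ (y 3 ⊗ z))
    ≈⟨ ⊗-cong (prod₄ n) (⊗-congʳ (y 3 ⊗ z) (⊗-cong (E⁺⊗E (1 ℕ.* (1 ℕ.+ n ℕ.* 3)) (d₁ n)) (E⁺⊗E (1 ℕ.* (2 ℕ.+ n ℕ.* 3)) (d₂ n)))) ⟩
  M ⊗ M′ ⊗ (y 1 ⊗ y 2 ⊗ (y 3 ⊗ z))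
    ≈⟨ solveᴹ 6 (λ m m′ y₁ y₂ y₃ z → m ∙ m′ ∙ (y₁ ∙ y₂ ∙ (y₃ ∙ z)) ≜ m ∙ y₁ ∙ y₂ ∙ y₃ ∙ (m′ ∙ z))
         PSR.refl M M′ (y 1) (y 2) (y 3) z ⟩
  M ⊗ y 1 ⊗ y 2 ⊗ y 3 ⊗ (M′ ⊗ z) ∎
  where
  open SetoidReasoning PSR.setoid
  P P′ S S′ M M′ z : PS
  P = Gauss.prod (qpow 3) (qpow 1) n
  P′ = Gauss.prod (qpow 3) (qpow 2) n
  S = fp 6 n
  S′ = fp 1 (n ℕ.* 3)
  M = fp 2 (n ℕ.* 3)
  M′ = fp 3 n
  z = E (3 ℕ.* suc n)
  x x⁺ y : ℕ → PS
  x i = E (1 ℕ.* (i ℕ.+ n ℕ.* 3))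
  x⁺ i = E⁺ (1 ℕ.* (i ℕ.+ n ℕ.* 3))
  y i = E (2 ℕ.* (i ℕ.+ n ℕ.* 3))
  e₁ : ∀ n → 1 ℕ.* (1 ℕ.+ n ℕ.* 3) ≡ 1 ℕ.+ 3 ℕ.* n
  e₁ = ℕSolver.solve-∀
  e₂ : ∀ n → 1 ℕ.* (2 ℕ.+ n ℕ.* 3) ≡ 2 ℕ.+ 3 ℕ.* n
  e₂ = ℕSolver.solve-∀
  e₃ : ∀ n → 1 ℕ.* (3 ℕ.+ n ℕ.* 3) ≡ 3 ℕ.* (1 ℕ.+ n)
  e₃ = ℕSolver.solve-∀
  e₆ : ∀ n → 6 ℕ.* (1 ℕ.+ n) ≡ 2 ℕ.* (3 ℕ.+ n ℕ.* 3)
  e₆ = ℕSolver.solve-∀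
  d₁ : ∀ n → 2 ℕ.* (1 ℕ.+ n ℕ.* 3) ≡ 1 ℕ.* (1 ℕ.+ n ℕ.* 3) ℕ.+ 1 ℕ.* (1 ℕ.+ n ℕ.* 3)
  d₁ = ℕSolver.solve-∀
  d₂ : ∀ n → 2 ℕ.* (2 ℕ.+ n ℕ.* 3) ≡ 1 ℕ.* (2 ℕ.+ n ℕ.* 3) ℕ.+ 1 ℕ.* (2 ℕ.+ n ℕ.* 3)
  d₂ = ℕSolver.solve-∀

-- Theta series as eta quotients

⊟-head : ∀ a → a 0 ≡ + 0 → (⊟ a) 0 ≡ + 0
⊟-head a a₀ = trans (⊟-at a 0) (cong -_ a₀)

⊟⊗⊟ : ∀ m n → (⊟ qpow m) ⊗ (⊟ qpow n) ≈ qpow (m ℕ.+ n)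
⊟⊗⊟ m n = PSR.trans (solve 2 (λ x y → :- x :* :- y := x :* y) PSR.refl (qpow m) (qpow n))
  (PSR.sym (qpow-+ m n))

-- `ψΘ` is all of ψ, the sum of q^(n(n+1)/2) over n ≥ 0, while φ, the sum of (-1)ⁿq^(n²) over ℤ, is
-- 2`φΘ` - 1. `ωΘ` - 1 and `χΘ` - 1 are the sums over ℤ of (-1)ⁿq^(3n²-2n) and q^(n(3n-1)/2).
φΘ ψΘ ωΘ χΘ : PS
φΘ = Θ (qpow 2) (⊟ qpow 1)
ψΘ = Θ (qpow 1) (qpow 1)
ωΘ = Θ (qpow 6) (⊟ qpow 1) ⊞ Θ (qpow 6) (⊟ qpow 5)
χΘ = Θ (qpow 3) (qpow 1) ⊞ Θ (qpow 3) (qpow 2)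

fp→f : ∀ m {k} N → k ℕ.≤ N → fp (suc m) N ≈[ just k ] f (suc m)
fp→f m N k≤N = PSₚ.sym _ (f≈fp m N (ℕₚ.m≤n⇒m≤1+n k≤N))

f₂φ : f 2 ⊗ (φΘ ⊞ φΘ) ≈ f 1 ⊗ f 1 ⊞ f 2
f₂φ = ≈-from-truncations λ k → let
    open PSₚ (just k) using (setoid)
    open SetoidReasoning setoid
    O = Gauss.prod (qpow 2) (⊟ qpow 1) k
    O⊗f₂ : O ⊗ f 2 ≈[ just k ] f 1
    O⊗f₂ = PSₚ.trans (just k) (⊗-congˡ O (f≈fp 1 k (ℕₚ.n≤1+n k)))
      (PSₚ.trans (just k) (≈-weaken _ (prod₁ k)) (fp→f 0 (k ℕ.* 2) (ℕₚ.m≤m*n k 2)))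
  in begin
    f 2 ⊗ (φΘ ⊞ φΘ)
      ≈⟨ ⊗-congˡ (f 2) (PSₚ.sym (just k) (TripleProduct.jacobi 1 (⊟ qpow 1) (⊟ qpow 1)
           (⊟-head (qpow 1) refl) (⊟-head (qpow 1) refl) (⊟⊗⊟ 1 1) k)) ⟩
    f 2 ⊗ (f 2 ⊗ (O ⊗ O) ⊞ 𝟙)
      ≈⟨ ≈-weaken _ (solve 2 (λ f o → f :* (f :* (o :* o) :+ f :^ 0) := (o :* f) :* (o :* f) :+ f) PSR.refl (f 2) O) ⟩
    (O ⊗ f 2) ⊗ (O ⊗ f 2) ⊞ f 2
      ≈⟨ ⊞-congʳ (f 2) (⊗-cong O⊗f₂ O⊗f₂) ⟩
    f 1 ⊗ f 1 ⊞ f 2 ∎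

f₁ψ : f 1 ⊗ ψΘ ≈ f 2 ⊗ f 2
f₁ψ = ≈-from-truncations λ k → let
    open PSₚ (just k) using (setoid)
    open SetoidReasoning setoid
    O = Gauss.prod (qpow 1) (qpow 1) k
    O⊗f₁ : O ⊗ f 1 ≈[ just k ] f 2
    O⊗f₁ = PSₚ.trans (just k) (⊗-congˡ O (f≈fp 0 k (ℕₚ.n≤1+n k)))
      (PSₚ.trans (just k) (≈-weaken _ (prod₂ k)) (fp→f 1 k ℕₚ.≤-refl))
  in begin
    f 1 ⊗ ψΘ
      ≈⟨ ⊗-congˡ (f 1) (PSₚ.sym (just k) (TripleProduct.jacobi-Q 0 k)) ⟩
    f 1 ⊗ (f 1 ⊗ (O ⊗ O))
      ≈⟨ ≈-weaken _ (solve 2 (λ f o → f :* (f :* (o :* o)) := (o :* f) :* (o :* f)) PSR.refl (f 1) O) ⟩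
    (O ⊗ f 1) ⊗ (O ⊗ f 1)
      ≈⟨ ⊗-cong O⊗f₁ O⊗f₁ ⟩
    f 2 ⊗ f 2 ∎

f₂f₃ω : f 2 ⊗ f 3 ⊗ ωΘ ≈ f 1 ⊗ f 6 ⊗ f 6 ⊞ f 2 ⊗ f 3
f₂f₃ω = ≈-from-truncations λ k → let
    open PSₚ (just k) using (setoid)
    open SetoidReasoning setoid
    A = Gauss.prod (qpow 6) (⊟ qpow 1) k
    B = Gauss.prod (qpow 6) (⊟ qpow 5) k
  in begin
    f 2 ⊗ f 3 ⊗ ωΘ
      ≈⟨ ⊗-congˡ (f 2 ⊗ f 3) (PSₚ.sym (just k) (TripleProduct.jacobi 5 (⊟ qpow 1) (⊟ qpow 5)
           (⊟-head (qpow 1) refl) (⊟-head (qpow 5) refl) (⊟⊗⊟ 1 5) k)) ⟩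
    f 2 ⊗ f 3 ⊗ (f 6 ⊗ (A ⊗ B) ⊞ 𝟙)
      ≈⟨ ≈-weaken _ (solve 5 (λ f₂ f₃ f₆ a b → f₂ :* f₃ :* (f₆ :* (a :* b) :+ f₂ :^ 0)
           := a :* b :* (f₂ :* f₃) :* f₆ :+ f₂ :* f₃) PSR.refl (f 2) (f 3) (f 6) A B) ⟩
    A ⊗ B ⊗ (f 2 ⊗ f 3) ⊗ f 6 ⊞ f 2 ⊗ f 3
      ≈⟨ ⊞-congʳ (f 2 ⊗ f 3) (⊗-congʳ (f 6) (PSₚ.trans (just k)
           (⊗-congˡ (A ⊗ B) (⊗-cong (PSₚ.sym (just k) (fp→f 1 (k ℕ.* 3) (ℕₚ.m≤m*n k 3)))
             (PSₚ.sym (just k) (fp→f 2 (k ℕ.* 2) (ℕₚ.m≤m*n k 2)))))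
           (PSₚ.trans (just k) (≈-weaken _ (prod₃ k)) (⊗-cong (fp→f 0 (k ℕ.* 6) (ℕₚ.m≤m*n k 6)) (fp→f 5 k ℕₚ.≤-refl))))) ⟩
    f 1 ⊗ f 6 ⊗ f 6 ⊞ f 2 ⊗ f 3 ∎

f₆f₁χ : f 6 ⊗ f 1 ⊗ χΘ ≈ f 2 ⊗ f 3 ⊗ f 3 ⊞ f 6 ⊗ f 1
f₆f₁χ = ≈-from-truncations λ k → let
    open PSₚ (just k) using (setoid)
    open SetoidReasoning setoid
    A = Gauss.prod (qpow 3) (qpow 1) k
    B = Gauss.prod (qpow 3) (qpow 2) k
  in begin
    f 6 ⊗ f 1 ⊗ χΘ
      ≈⟨ ⊗-congˡ (f 6 ⊗ f 1) (PSₚ.sym (just k) (TripleProduct.jacobi 2 (qpow 1) (qpow 2)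
           refl refl (PSR.sym (qpow-+ 1 2)) k)) ⟩
    f 6 ⊗ f 1 ⊗ (f 3 ⊗ (A ⊗ B) ⊞ 𝟙)
      ≈⟨ ≈-weaken _ (solve 5 (λ f₆ f₁ f₃ a b → f₆ :* f₁ :* (f₃ :* (a :* b) :+ f₆ :^ 0)
           := a :* b :* (f₆ :* f₁) :* f₃ :+ f₆ :* f₁) PSR.refl (f 6) (f 1) (f 3) A B) ⟩
    A ⊗ B ⊗ (f 6 ⊗ f 1) ⊗ f 3 ⊞ f 6 ⊗ f 1
      ≈⟨ ⊞-congʳ (f 6 ⊗ f 1) (⊗-congʳ (f 3) (PSₚ.trans (just k)
           (⊗-congˡ (A ⊗ B) (⊗-cong (PSₚ.sym (just k) (fp→f 5 k ℕₚ.≤-refl))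
             (PSₚ.sym (just k) (fp→f 0 (k ℕ.* 3) (ℕₚ.m≤m*n k 3)))))
           (PSₚ.trans (just k) (≈-weaken _ (prod₄ k)) (⊗-cong (fp→f 1 (k ℕ.* 3) (ℕₚ.m≤m*n k 3)) (fp→f 2 k ℕₚ.≤-refl))))) ⟩
    f 2 ⊗ f 3 ⊗ f 3 ⊞ f 6 ⊗ f 1 ∎

-- Trisecting the theta series

Θ-cong : ∀ {Q Q′ x x′} → Q ≈ Q′ → x ≈ x′ → Θ Q x ≈ Θ Q′ x′
Θ-cong eQ ex = pointwise λ n → at (theta-cong eQ ex (suc n)) n tt

Θ-unfold : ∀ Q x → x 0 ≡ + 0 → Θ Q x ≈ 𝟙 ⊞ x ⊗ Θ Q (x ⊗ Q)
Θ-unfold Q x x₀ = ≈-from-truncations λ k → PSₚ.trans (just k)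
  (PSₚ.sym (just k) (theta→Θ Q x x₀ (suc k) (ℕₚ.n≤1+n k)))
  (⊞-congˡ 𝟙 (⊗-congˡ x (theta→Θ Q (x ⊗ Q) (⊗-head-zero x Q x₀) k ℕₚ.≤-refl)))

Θ-trisect : ∀ Q x → x 0 ≡ + 0 → Θ Q x
  ≈ Θ (Q ^ᴿ 9) (x ^ᴿ 3 ⊗ Q ^ᴿ 3) ⊞ x ⊗ Θ (Q ^ᴿ 9) (x ^ᴿ 3 ⊗ Q ^ᴿ 6)
    ⊞ x ⊗ x ⊗ Q ⊗ Θ (Q ^ᴿ 9) (x ^ᴿ 3 ⊗ Q ^ᴿ 9)
Θ-trisect Q x x₀ = ≈-from-truncations λ k → let
    lim : ∀ w → theta (Q ^ᴿ 9) k (x ^ᴿ 3 ⊗ w) ≈[ just k ] Θ (Q ^ᴿ 9) (x ^ᴿ 3 ⊗ w)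
    lim w = theta→Θ (Q ^ᴿ 9) (x ^ᴿ 3 ⊗ w) (⊗-head-zero (x ^ᴿ 3) w (⊗-head-zero x (x ^ᴿ 2) x₀)) k ℕₚ.≤-refl
  in PSₚ.trans (just k) (PSₚ.sym (just k) (theta→Θ Q x x₀ (k ℕ.* 3) (ℕₚ.m≤m*n k 3)))
    (PSₚ.trans (just k) (≈-weaken (just k) (theta-trisect Q x k))
      (⊞-cong (⊞-cong (lim (Q ^ᴿ 3)) (⊗-congˡ x (lim (Q ^ᴿ 6)))) (⊗-congˡ (x ⊗ x ⊗ Q) (lim (Q ^ᴿ 9)))))

qpow-monomial : ∀ m n k → qpow m ^ᴿ 3 ⊗ qpow n ^ᴿ k ≈ qpow (m ℕ.* 3 ℕ.+ n ℕ.* k)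
qpow-monomial m n k = PSR.trans (⊗-cong (qpow-* m 3) (qpow-* n k)) (PSR.sym (qpow-+ (m ℕ.* 3) (n ℕ.* k)))

⊟qpow-monomial : ∀ m n k → (⊟ qpow m) ^ᴿ 3 ⊗ qpow n ^ᴿ k ≈ ⊟ qpow (m ℕ.* 3 ℕ.+ n ℕ.* k)
⊟qpow-monomial m n k = PSR.trans
  (solve 2 (λ x y → (:- x) :^ 3 :* y := :- (x :^ 3 :* y)) PSR.refl (qpow m) (qpow n ^ᴿ k))
  (⊟-cong (qpow-monomial m n k))

dil-Θ⁺ : ∀ m n → dil (Θ (qpow m) (qpow (suc n))) ≈ Θ (qpow (3 ℕ.* m)) (qpow (3 ℕ.* suc n))
dil-Θ⁺ m n = PSR.trans (dil-Θ (qpow m) (qpow (suc n)) refl) (Θ-cong (dil-qpow m) (dil-qpow (suc n)))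

dil-Θ⁻ : ∀ m n → dil (Θ (qpow m) (⊟ qpow (suc n))) ≈ Θ (qpow (3 ℕ.* m)) (⊟ qpow (3 ℕ.* suc n))
dil-Θ⁻ m n = PSR.trans (dil-Θ (qpow m) (⊟ qpow (suc n)) (⊟-head (qpow (suc n)) refl))
  (Θ-cong (dil-qpow m) (PSR.trans (dil-⊟ (qpow (suc n))) (⊟-cong (dil-qpow (suc n)))))

-- Squares are 0 or 1 modulo 3, so the last component vanishes. The n ≥ 0 congruent to 1 and to 2
-- supply the terms of ω with index ≤ 0 and > 0; peeling its first term off one half of `ωΘ` removes
-- the shared index 0.
φΘ-trisect : φΘ ≈ tri (dil φΘ) (⊟ (ωΘ ⊞ ⊟ 𝟙)) 𝟘
φΘ-trisect = begin
  φΘ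
    ≈⟨ Θ-trisect (qpow 2) (⊟ q) (⊟-head q refl) ⟩
  Θ (qpow 2 ^ᴿ 9) ((⊟ q) ^ᴿ 3 ⊗ qpow 2 ^ᴿ 3) ⊞ (⊟ q) ⊗ Θ (qpow 2 ^ᴿ 9) ((⊟ q) ^ᴿ 3 ⊗ qpow 2 ^ᴿ 6)
    ⊞ (⊟ q) ⊗ (⊟ q) ⊗ qpow 2 ⊗ Θ (qpow 2 ^ᴿ 9) ((⊟ q) ^ᴿ 3 ⊗ qpow 2 ^ᴿ 9)
    ≈⟨ ⊞-cong (⊞-cong (term 3) (⊗-congˡ (⊟ q) (term 6)))
         (⊗-cong (⊗-congˡ ((⊟ q) ⊗ (⊟ q)) (qpow-+ 1 1)) (term 9)) ⟩
  Θ (qpow 18) (⊟ qpow 9) ⊞ (⊟ q) ⊗ Θ (qpow 18) (⊟ qpow 15)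
    ⊞ (⊟ q) ⊗ (⊟ q) ⊗ (q ⊗ q) ⊗ Θ (qpow 18) (⊟ qpow 21)
    ≈⟨ ⊞-cong (⊞-cong dd (⊗-congˡ (⊟ q) (dil-Θ⁻ 6 4))) (⊗-congˡ ((⊟ q) ⊗ (⊟ q) ⊗ (q ⊗ q)) (dil-Θ⁻ 6 6)) ⟨
  dil (dil φΘ) ⊞ (⊟ q) ⊗ dil A ⊞ (⊟ q) ⊗ (⊟ q) ⊗ (q ⊗ q) ⊗ dil B
    ≈⟨ solve 4 (λ q a b d → d :+ :- q :* a :+ :- q :* :- q :* (q :* q) :* b
         := d :+ q :* (:- (a :- q :^ 3 :* b)) :+ q :* (q :* (q :- q))) PSR.refl q (dil A) (dil B) (dil (dil φΘ)) ⟩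
  dil (dil φΘ) ⊞ q ⊗ (⊟ (dil A ⊞ ⊟ (q ^ᴿ 3 ⊗ dil B))) ⊞ q ⊗ (q ⊗ (q ⊞ ⊟ q))
    ≈⟨ ⊞-cong (⊞-congˡ (dil (dil φΘ)) (⊗-congˡ q dil-ω)) (⊗-congˡ q (⊗-congˡ q dil-𝟘′)) ⟨
  dil (dil φΘ) ⊞ q ⊗ dil (⊟ (ωΘ ⊞ ⊟ 𝟙)) ⊞ q ⊗ (q ⊗ dil 𝟘)
    ≈⟨ tri-dil (dil φΘ) (⊟ (ωΘ ⊞ ⊟ 𝟙)) 𝟘 ⟨
  tri (dil φΘ) (⊟ (ωΘ ⊞ ⊟ 𝟙)) 𝟘 ∎
  where
  open SetoidReasoning PSR.setoid
  A B : PS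
  A = Θ (qpow 6) (⊟ qpow 5)
  B = Θ (qpow 6) (⊟ qpow 7)
  term : ∀ k → Θ (qpow 2 ^ᴿ 9) ((⊟ q) ^ᴿ 3 ⊗ qpow 2 ^ᴿ k) ≈ Θ (qpow 18) (⊟ qpow (3 ℕ.+ 2 ℕ.* k))
  term k = Θ-cong (qpow-* 2 9) (⊟qpow-monomial 1 2 k)
  dd : dil (dil φΘ) ≈ Θ (qpow 18) (⊟ qpow 9)
  dd = PSR.trans (dil-cong (dil-Θ⁻ 2 0)) (dil-Θ⁻ 6 2)
  ω≈ : ωΘ ⊞ ⊟ 𝟙 ≈ A ⊞ ⊟ (q ⊗ B)
  ω≈ = PSR.trans (⊞-congʳ (⊟ 𝟙) (⊞-congʳ A (PSR.trans (Θ-unfold (qpow 6) (⊟ q) (⊟-head q refl))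
      (⊞-congˡ 𝟙 (⊗-congˡ (⊟ q) (Θ-cong PSR.refl
        (PSR.trans (solve 2 (λ x y → :- x :* y := :- (x :* y)) PSR.refl q (qpow 6)) (⊟-cong (q⊗qpow 6)))))))))
    (solve 3 (λ q a b → q :^ 0 :+ :- q :* b :+ a :- q :^ 0 := a :- q :* b) PSR.refl q A B)
  dil-ω : dil (⊟ (ωΘ ⊞ ⊟ 𝟙)) ≈ ⊟ (dil A ⊞ ⊟ (q ^ᴿ 3 ⊗ dil B))
  dil-ω = PSR.trans (dil-⊟ (ωΘ ⊞ ⊟ 𝟙)) (⊟-cong (PSR.trans (dil-cong ω≈) (PSR.trans (dil-⊞ A (⊟ (q ⊗ B)))
    (⊞-congˡ (dil A) (PSR.trans (dil-⊟ (q ⊗ B)) (⊟-cong (dil-q⊗ B)))))))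

-- Triangular numbers are 0 or 1 modulo 3. Those with n = 3j + 1 are 1 + 9j(j+1)/2 and reproduce ψ;
-- the others are three times the generalised pentagonal numbers.
ψΘ-trisect : ψΘ ≈ tri (χΘ ⊞ ⊟ 𝟙) (dil ψΘ) 𝟘
ψΘ-trisect = begin
  ψΘ
    ≈⟨ Θ-trisect q q refl ⟩
  Θ (q ^ᴿ 9) (q ^ᴿ 3 ⊗ q ^ᴿ 3) ⊞ q ⊗ Θ (q ^ᴿ 9) (q ^ᴿ 3 ⊗ q ^ᴿ 6) ⊞ q ⊗ q ⊗ q ⊗ Θ (q ^ᴿ 9) (q ^ᴿ 3 ⊗ q ^ᴿ 9)
    ≈⟨ ⊞-cong (⊞-cong (term 3) (⊗-congˡ q (term 6))) (⊗-congˡ (q ⊗ q ⊗ q) (term 9)) ⟩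
  Θ (qpow 9) (qpow 6) ⊞ q ⊗ Θ (qpow 9) (qpow 9) ⊞ q ⊗ q ⊗ q ⊗ Θ (qpow 9) (qpow 12)
    ≈⟨ ⊞-cong (⊞-cong (dil-Θ⁺ 3 1) (⊗-congˡ q dd)) (⊗-congˡ (q ⊗ q ⊗ q) (dil-Θ⁺ 3 3)) ⟨
  dil A ⊞ q ⊗ dil (dil ψΘ) ⊞ q ⊗ q ⊗ q ⊗ dil B
    ≈⟨ solve 4 (λ q a b d → a :+ q :* d :+ q :* q :* q :* b
         := (a :+ q :^ 3 :* b) :+ q :* d :+ q :* (q :* (q :- q))) PSR.refl q (dil A) (dil B) (dil (dil ψΘ)) ⟩
  dil A ⊞ q ^ᴿ 3 ⊗ dil B ⊞ q ⊗ dil (dil ψΘ) ⊞ q ⊗ (q ⊗ (q ⊞ ⊟ q))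
    ≈⟨ ⊞-cong (⊞-congʳ (q ⊗ dil (dil ψΘ)) dil-χ) (⊗-congˡ q (⊗-congˡ q dil-𝟘′)) ⟨
  dil (χΘ ⊞ ⊟ 𝟙) ⊞ q ⊗ dil (dil ψΘ) ⊞ q ⊗ (q ⊗ dil 𝟘)
    ≈⟨ tri-dil (χΘ ⊞ ⊟ 𝟙) (dil ψΘ) 𝟘 ⟨
  tri (χΘ ⊞ ⊟ 𝟙) (dil ψΘ) 𝟘 ∎
  where
  open SetoidReasoning PSR.setoid
  A B : PS
  A = Θ (qpow 3) (qpow 2)
  B = Θ (qpow 3) (qpow 4)
  term : ∀ k → Θ (q ^ᴿ 9) (q ^ᴿ 3 ⊗ q ^ᴿ k) ≈ Θ (qpow 9) (qpow (3 ℕ.+ 1 ℕ.* k))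
  term k = Θ-cong (qpow-* 1 9) (qpow-monomial 1 1 k)
  dd : dil (dil ψΘ) ≈ Θ (qpow 9) (qpow 9)
  dd = PSR.trans (dil-cong (dil-Θ⁺ 1 0)) (dil-Θ⁺ 3 2)
  χ≈ : χΘ ⊞ ⊟ 𝟙 ≈ A ⊞ q ⊗ B
  χ≈ = PSR.trans (⊞-congʳ (⊟ 𝟙) (⊞-congʳ A (PSR.trans (Θ-unfold (qpow 3) q refl)
      (⊞-congˡ 𝟙 (⊗-congˡ q (Θ-cong PSR.refl (q⊗qpow 3)))))))
    (solve 3 (λ q a b → q :^ 0 :+ q :* b :+ a :- q :^ 0 := a :+ q :* b) PSR.refl q A B)
  dil-χ : dil (χΘ ⊞ ⊟ 𝟙) ≈ dil A ⊞ q ^ᴿ 3 ⊗ dil B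
  dil-χ = PSR.trans (dil-cong χ≈) (PSR.trans (dil-⊞ A (q ⊗ B)) (⊞-congˡ (dil A) (dil-q⊗ B)))

-- Eta quotients

open import Algebra.Solver.CommutativeMonoid.Normal PSR.*-commutativeMonoid using (normalise; correct; var; Env; ⟦_⟧; ⟦_⟧⇓)

infixr 8 _^ᴹ_
_^ᴹ_ : ∀ {n} → Monomial n → ℕ → Monomial n
e ^ᴹ zero  = ε
e ^ᴹ suc k = e ∙ e ^ᴹ k

-- The normal form of a monomial is a vector of natural exponents. Inverses therefore enter as
-- separate variables, and cancellations have to be counted.
etas : Env 8
etas = f 1 ∷ f 2 ∷ f 3 ∷ f 6 ∷ f⁻¹ 1 ∷ f⁻¹ 2 ∷ f⁻¹ 3 ∷ f⁻¹ 6 ∷ []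

F₁ F₂ F₃ F₆ I₁ I₂ I₃ I₆ : Monomial 8
F₁ = var (# 0)
F₂ = var (# 1)
F₃ = var (# 2)
F₆ = var (# 3)
I₁ = var (# 4)
I₂ = var (# 5)
I₃ = var (# 6)
I₆ = var (# 7)

⟦_⟧η : Monomial 8 → PS
⟦ e ⟧η = ⟦ e ⟧ etas

units : (a b c d : ℕ) → Monomial 8
units a b c d = (F₁ ∙ I₁) ^ᴹ a ∙ (F₂ ∙ I₂) ^ᴹ b ∙ (F₃ ∙ I₃) ^ᴹ c ∙ (F₆ ∙ I₆) ^ᴹ d

cancel : ∀ e a b c d → ⟦ e ∙ units a b c d ⟧η ≈ ⟦ e ⟧η
cancel e a b c d = PSR.trans
  (⊗-congˡ ⟦ e ⟧η (⊗-cong (⊗-cong (⊗-cong (one F₁ I₁ (f⊗f⁻¹ 1) a) (one F₂ I₂ (f⊗f⁻¹ 2) b)) (one F₃ I₃ (f⊗f⁻¹ 3) c))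
    (one F₆ I₆ (f⊗f⁻¹ 6) d)))
  (solve 1 (λ x → let :1 = x :^ 0 in x :* (:1 :* :1 :* :1 :* :1) := x) PSR.refl ⟦ e ⟧η)
  where
  one : ∀ u v → ⟦ u ∙ v ⟧η ≈ 𝟙 → ∀ k → ⟦ (u ∙ v) ^ᴹ k ⟧η ≈ 𝟙
  one u v uv zero    = PSR.refl
  one u v uv (suc k) = PSR.trans (⊗-cong uv (one u v uv k)) (PSR.*-identityˡ 𝟙)

-- Two eta quotients agree when their exponents do, up to the factors f₁f₁⁻¹, f₂f₂⁻¹, f₃f₃⁻¹, f₆f₆⁻¹
-- with multiplicities a, b, c, d.
eta≈ : ∀ e e′ a b c d →
  normalise e ≡ normalise (e′ ∙ units a b c d) →
  ⟦ e ⟧η ≈ ⟦ e′ ⟧η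
eta≈ e e′ a b c d h = PSR.trans (PSR.sym (correct e etas))
  (PSR.trans (PSR.reflexive (cong (λ v → ⟦ v ⟧⇓ etas) h)) (PSR.trans (correct (e′ ∙ units a b c d) etas) (cancel e′ a b c d)))

-- `φη` and `ψη` are φ and ψ, `wη` and `xη` the two-sided sums ω and χ; `aη` and `bη` are φ and ψ at
-- q³.
φη ψη wη xη aη bη Y T T⁻¹ : Monomial 8
φη = F₁ ∙ F₁ ∙ I₂
ψη = F₂ ∙ F₂ ∙ I₁
wη = F₁ ∙ F₆ ∙ F₆ ∙ (I₂ ∙ I₃)
xη = F₂ ∙ F₃ ∙ F₃ ∙ (I₆ ∙ I₁)
aη = F₃ ∙ F₃ ∙ I₆
bη = F₆ ∙ F₆ ∙ I₃
Y = F₃ ∙ F₆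
T = F₂ ∙ F₃ ^ᴹ 3 ∙ I₁ ∙ I₆ ^ᴹ 3
T⁻¹ = F₁ ∙ F₆ ^ᴹ 3 ∙ I₂ ∙ I₃ ^ᴹ 3

φη≈φΘ : φΘ ⊞ φΘ ⊞ ⊟ 𝟙 ≈ ⟦ φη ⟧η
φη≈φΘ = quotient-1 (f⊗f⁻¹ 2) f₂φ

ψη≈ψΘ : ψΘ ≈ ⟦ ψη ⟧η
ψη≈ψΘ = quotient (f⊗f⁻¹ 1) f₁ψ

wη≈ωΘ : ωΘ ⊞ ⊟ 𝟙 ≈ ⟦ wη ⟧η
wη≈ωΘ = quotient-1 (eta≈ (F₂ ∙ F₃ ∙ (I₂ ∙ I₃)) ε 0 1 1 0 refl) f₂f₃ω

xη≈χΘ : χΘ ⊞ ⊟ 𝟙 ≈ ⟦ xη ⟧η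
xη≈χΘ = quotient-1 (eta≈ (F₆ ∙ F₁ ∙ (I₆ ∙ I₁)) ε 1 0 0 1 refl) f₆f₁χ

dil-aab : ∀ a b {a′ b′} → dil a ≈ a′ → dil b ≈ b′ → dil (a ⊗ a ⊗ b) ≈ a′ ⊗ a′ ⊗ b′
dil-aab a b ea eb = PSR.trans (dil-⊗ (a ⊗ a) b) (⊗-cong (PSR.trans (dil-⊗ a a) (⊗-cong ea ea)) eb)

φ-trisect : ⟦ φη ⟧η ≈ tri ⟦ aη ⟧η (⊟ (⟦ wη ⟧η ⊞ ⟦ wη ⟧η)) 𝟘
φ-trisect = begin
  ⟦ φη ⟧η
    ≈⟨ φη≈φΘ ⟨
  φΘ ⊞ φΘ ⊞ ⊟ 𝟙
    ≈⟨ ⊞-congʳ (⊟ 𝟙) (⊞-cong φΘ-expand φΘ-expand) ⟩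
  (dil D ⊞ q ⊗ (⊟ W) ⊞ q ⊗ (q ⊗ (q ⊞ ⊟ q))) ⊞ (dil D ⊞ q ⊗ (⊟ W) ⊞ q ⊗ (q ⊗ (q ⊞ ⊟ q))) ⊞ ⊟ 𝟙
    ≈⟨ solve 3 (λ q d w → let e = d :+ q :* (:- w) :+ q :* (q :* (q :- q)) in
         e :+ e :- q :^ 0 := (d :+ d :- q :^ 0) :+ q :* (:- (w :+ w)) :+ q :* (q :* (q :- q))) PSR.refl q (dil D) W ⟩
  (dil D ⊞ dil D ⊞ ⊟ 𝟙) ⊞ q ⊗ (⊟ (W ⊞ W)) ⊞ q ⊗ (q ⊗ (q ⊞ ⊟ q))
    ≈⟨ ⊞-cong (⊞-cong dil-a (⊗-congˡ q (PSR.trans (dil-⊟ (w ⊞ w)) (⊟-cong (dil-⊞ w w))))) (⊗-congˡ q (⊗-congˡ q dil-𝟘′)) ⟨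
  dil ⟦ aη ⟧η ⊞ q ⊗ dil (⊟ (w ⊞ w)) ⊞ q ⊗ (q ⊗ dil 𝟘)
    ≈⟨ tri-dil ⟦ aη ⟧η (⊟ (w ⊞ w)) 𝟘 ⟨
  tri ⟦ aη ⟧η (⊟ (w ⊞ w)) 𝟘 ∎
  where
  open SetoidReasoning PSR.setoid
  D w W : PS
  D = dil φΘ
  w = ⟦ wη ⟧η
  W = dil w
  φΘ-expand : φΘ ≈ dil D ⊞ q ⊗ (⊟ W) ⊞ q ⊗ (q ⊗ (q ⊞ ⊟ q))
  φΘ-expand = PSR.trans φΘ-trisect (PSR.trans (tri-dil D (⊟ (ωΘ ⊞ ⊟ 𝟙)) 𝟘)
    (⊞-cong (⊞-congˡ (dil D) (⊗-congˡ q (PSR.trans (dil-⊟ (ωΘ ⊞ ⊟ 𝟙)) (⊟-cong (dil-cong wη≈ωΘ)))))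
      (⊗-congˡ q (⊗-congˡ q dil-𝟘′))))
  dil-minus : ∀ u → dil (u ⊞ u ⊞ ⊟ 𝟙) ≈ dil u ⊞ dil u ⊞ ⊟ 𝟙
  dil-minus u = PSR.trans (dil-⊞ (u ⊞ u) (⊟ 𝟙)) (⊞-cong (dil-⊞ u u) (PSR.trans (dil-⊟ 𝟙) (⊟-cong dil-𝟙)))
  dil-a : dil ⟦ aη ⟧η ≈ dil D ⊞ dil D ⊞ ⊟ 𝟙
  dil-a = PSR.trans (dil-cong (PSR.trans (PSR.sym (dil-aab (f 1) (f⁻¹ 2) (dil-f 0) (dil-f⁻¹ 1)))
    (PSR.trans (dil-cong (PSR.sym φη≈φΘ)) (dil-minus φΘ)))) (dil-minus D)

ψ-trisect : ⟦ ψη ⟧η ≈ tri ⟦ xη ⟧η ⟦ bη ⟧η 𝟘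
ψ-trisect = PSR.trans (PSR.sym ψη≈ψΘ) (PSR.trans ψΘ-trisect (tri-cong xη≈χΘ
  (PSR.trans (dil-cong ψη≈ψΘ) (dil-aab (f 2) (f⁻¹ 1) (dil-f 1) (dil-f⁻¹ 0))) PSR.refl))

-- The trisection of f₁f₂ and its cofactor

y t τ : PS
y = ⟦ Y ⟧η
t = ⟦ T ⟧η
τ = ⟦ T⁻¹ ⟧η

t⊗τ : t ⊗ τ ≈ 𝟙
t⊗τ = eta≈ (T ∙ T⁻¹) ε 1 1 3 3 refl

f₁f₂-trisect : f 1 ⊗ f 2 ≈ tri (y ⊗ t) (⊟ y) (⊟ (y ⊗ τ ⊞ y ⊗ τ))
f₁f₂-trisect = begin
  f 1 ⊗ f 2               ≈⟨ eta≈ (φη ∙ ψη) (F₁ ∙ F₂) 1 1 0 0 refl ⟨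
  ⟦ φη ⟧η ⊗ ⟦ ψη ⟧η       ≈⟨ ⊗-cong φ-trisect ψ-trisect ⟩
  tri a v 𝟘 ⊗ tri x b 𝟘   ≈⟨ tri-⊗ a v 𝟘 x b 𝟘 ⟩
  tri (a ⊗ x ⊞ q ⊗ (v ⊗ 𝟘 ⊞ 𝟘 ⊗ b)) (a ⊗ b ⊞ v ⊗ x ⊞ q ⊗ (𝟘 ⊗ 𝟘)) (a ⊗ 𝟘 ⊞ v ⊗ b ⊞ 𝟘 ⊗ x)
    ≈⟨ tri-cong (PSR.trans (linear₀ q a v x b) (PSR.sym (eta≈ (Y ∙ T) (aη ∙ xη) 0 0 0 1 refl)))
         (PSR.trans (linear₁ q a v x b) c₁) (PSR.trans (linear₂ a v x b) c₂) ⟩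
  tri (y ⊗ t) (⊟ y) (⊟ (y ⊗ τ ⊞ y ⊗ τ)) ∎
  where
  open SetoidReasoning PSR.setoid
  a w v x b : PS
  a = ⟦ aη ⟧η
  w = ⟦ wη ⟧η
  v = ⊟ (w ⊞ w)
  x = ⟦ xη ⟧η
  b = ⟦ bη ⟧η
  -- Both ab and wx equal y, and v = -2w, so the middle component is y - 2y.
  c₁ : a ⊗ b ⊞ v ⊗ x ≈ ⊟ y
  c₁ = lincomb₂ 𝟙 (⊟ (𝟙 ⊞ 𝟙))
    (solve 5 (λ a b w x y → let :1 = a :^ 0 in
        a :* b :+ (:- (w :+ w)) :* x :+ :1 :* y :+ (:- (:1 :+ :1)) :* y
      := :- y :+ :1 :* (a :* b) :+ (:- (:1 :+ :1)) :* (w :* x)) PSR.refl a b w x y)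
    (eta≈ (aη ∙ bη) Y 0 0 1 1 refl) (eta≈ (wη ∙ xη) Y 1 1 1 1 refl)
  c₂ : v ⊗ b ≈ ⊟ (y ⊗ τ ⊞ y ⊗ τ)
  c₂ = PSR.trans (solve 2 (λ w b → (:- (w :+ w)) :* b := :- (w :* b :+ w :* b)) PSR.refl w b)
    (⊟-cong (⊞-cong wb wb))
    where
    wb : w ⊗ b ≈ y ⊗ τ
    wb = PSR.sym (eta≈ (Y ∙ T⁻¹) (wη ∙ bη) 0 0 1 0 refl)

ν ν⁻¹ : PS
ν = norm q (y ⊗ t) (⊟ y) (⊟ (y ⊗ τ ⊞ y ⊗ τ))
ν⁻¹ = ⟦ F₃ ∙ F₆ ∙ (I₁ ∙ I₂) ^ᴹ 4 ⟧η

-- The two evaluations of the norm meet here: `ν` comes from the trisection, `ν⁻¹` from the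
-- products.
ν⊗ν⁻¹ : ν ⊗ ν⁻¹ ≈ 𝟙
ν⊗ν⁻¹ = begin
  ν ⊗ ν⁻¹
    ≈⟨ ⊗-congʳ ν⁻¹ (PSR.trans (PSR.sym (Norm-⊗ (f 1) (f 2)))
         (PSR.trans (Norm-cong f₁f₂-trisect) (Norm-tri (y ⊗ t) (⊟ y) (⊟ (y ⊗ τ ⊞ y ⊗ τ))))) ⟨
  Norm (f 1) ⊗ Norm (f 2) ⊗ (f 3 ⊗ f 6 ⊗ i)
    ≈⟨ solveᴹ 5 (λ n₁ n₂ f₃ f₆ i → n₁ ∙ n₂ ∙ (f₃ ∙ f₆ ∙ i) ≜ (n₁ ∙ f₃) ∙ (n₂ ∙ f₆) ∙ i)
         PSR.refl (Norm (f 1)) (Norm (f 2)) (f 3) (f 6) i ⟩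
  (Norm (f 1) ⊗ f 3) ⊗ (Norm (f 2) ⊗ f 6) ⊗ i
    ≈⟨ ⊗-congʳ i (⊗-cong Norm-f₁ Norm-f₂) ⟩
  ⟦ (F₁ ∙ (F₁ ∙ F₁ ∙ F₁)) ∙ (F₂ ∙ (F₂ ∙ F₂ ∙ F₂)) ∙ (I₁ ∙ I₂) ^ᴹ 4 ⟧η
    ≈⟨ eta≈ ((F₁ ∙ (F₁ ∙ F₁ ∙ F₁)) ∙ (F₂ ∙ (F₂ ∙ F₂ ∙ F₂)) ∙ (I₁ ∙ I₂) ^ᴹ 4) ε 4 4 0 0 refl ⟩
  𝟙 ∎
  where
  open SetoidReasoning PSR.setoid
  i : PS
  i = ⟦ (I₁ ∙ I₂) ^ᴹ 4 ⟧η

tri-const : ∀ a → tri a 𝟘 𝟘 ≈ dil a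
tri-const a = PSR.trans (tri-dil a 𝟘 𝟘) (PSR.trans
  (⊞-cong (⊞-congˡ (dil a) (⊗-congˡ q dil-𝟘′)) (⊗-congˡ q (⊗-congˡ q dil-𝟘′)))
  (solve 2 (λ q a → a :+ q :* (q :- q) :+ q :* (q :* (q :- q)) := a) PSR.refl q (dil a)))

-- The second factor is the product of the other two conjugates of a + bX + cX². The norm is free of
-- X, hence a series in q³.
tri-cofactor : ∀ a b c → tri a b c ⊗ tri (a ⊗ a ⊞ ⊟ (q ⊗ (b ⊗ c))) (q ⊗ (c ⊗ c) ⊞ ⊟ (a ⊗ b)) (b ⊗ b ⊞ ⊟ (a ⊗ c))
  ≈ dil (norm q a b c)
tri-cofactor a b c = PSR.trans (tri-⊗ a b c _ _ _) (PSR.trans (tri-cong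
  (solve 4 (λ q a b c → a :* (a :* a :- q :* (b :* c)) :+ q :* (b :* (b :* b :- a :* c) :+ c :* (q :* (c :* c) :- a :* b))
     := :norm q a b c) PSR.refl q a b c)
  (PSR.trans (solve 4 (λ q a b c → a :* (q :* (c :* c) :- a :* b) :+ b :* (a :* a :- q :* (b :* c)) :+ q :* (c :* (b :* b :- a :* c))
     := q :- q) PSR.refl q a b c) (PSR.sym (0≈x-x q)))
  (PSR.trans (solve 4 (λ q a b c → a :* (b :* b :- a :* c) :+ b :* (q :* (c :* c) :- a :* b) :+ c :* (a :* a :- q :* (b :* c))
     := q :- q) PSR.refl q a b c) (PSR.sym (0≈x-x q))))
  (tri-const (norm q a b c)))

-- The cofactor of yt - yX - 2yt⁻¹X² modulo X³ = q, simplified by t t⁻¹ = 1.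
c₀ c₁ c₂ C : PS
c₀ = y ⊗ y ⊗ (t ⊗ t ⊞ ⊟ (const (+ 2) ⊗ q ⊗ τ))
c₁ = y ⊗ y ⊗ (t ⊞ const (+ 4) ⊗ q ⊗ (τ ⊗ τ))
c₂ = y ⊗ y ⊗ const (+ 3)
C  = tri c₀ c₁ c₂

f₁f₂⊗C : f 1 ⊗ f 2 ⊗ C ≈ dil ν
f₁f₂⊗C = PSR.trans (⊗-cong f₁f₂-trisect (tri-cong e₀ e₁ e₂)) (tri-cofactor (y ⊗ t) (⊟ y) (⊟ (y ⊗ τ ⊞ y ⊗ τ)))
  where
  e₀ : c₀ ≈ (y ⊗ t) ⊗ (y ⊗ t) ⊞ ⊟ (q ⊗ ((⊟ y) ⊗ (⊟ (y ⊗ τ ⊞ y ⊗ τ))))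
  e₀ = solve 4 (λ q y t τ → y :* y :* (t :* t :- con (+ 2) :* q :* τ)
    := (y :* t) :* (y :* t) :- q :* (:- y :* :- (y :* τ :+ y :* τ))) PSR.refl q y t τ
  e₁ : c₁ ≈ q ⊗ ((⊟ (y ⊗ τ ⊞ y ⊗ τ)) ⊗ (⊟ (y ⊗ τ ⊞ y ⊗ τ))) ⊞ ⊟ (y ⊗ t ⊗ (⊟ y))
  e₁ = solve 4 (λ q y t τ → y :* y :* (t :+ con (+ 4) :* q :* (τ :* τ))
    := q :* (:- (y :* τ :+ y :* τ) :* :- (y :* τ :+ y :* τ)) :- (y :* t :* :- y)) PSR.refl q y t τ
  e₂ : c₂ ≈ (⊟ y) ⊗ (⊟ y) ⊞ ⊟ (y ⊗ t ⊗ (⊟ (y ⊗ τ ⊞ y ⊗ τ)))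
  -- The 3 arises as 1 + 2tτ.
  e₂ = lincomb (⊟ (const (+ 2) ⊗ (y ⊗ y)))
    (solve 3 (λ y t τ → let :1 = y :^ 0 in
        y :* y :* con (+ 3) :+ :- (con (+ 2) :* (y :* y)) :* :1
      := :- y :* :- y :- y :* t :* :- (y :* τ :+ y :* τ) :+ :- (con (+ 2) :* (y :* y)) :* (t :* τ)) PSR.refl y t τ)
    t⊗τ

-- The coefficients of the theorem appear on squaring the cofactor with tτ = 1: 2 = 6 - 4 and 28 = 4
-- + 24, then 13 = 8 - 4 + 9 and -16, then 7 = 6 + 1, -4 = 8 - 12 and 16.
y⁴ s₀ s₁ s₂ : PS
y⁴ = ⟦ Y ^ᴹ 4 ⟧η
s₀ = y⁴ ⊗ (t ^ᴿ 4) ⊞ const (+ 2) ⊗ q ⊗ (y⁴ ⊗ t) ⊞ const (+ 28) ⊗ (q ⊗ q) ⊗ (y⁴ ⊗ τ ^ᴿ 2)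
s₁ = const (+ 2) ⊗ (y⁴ ⊗ t ^ᴿ 3) ⊞ const (+ 13) ⊗ q ⊗ y⁴ ⊞ ⊟ (const (+ 16) ⊗ (q ⊗ q) ⊗ (y⁴ ⊗ τ ^ᴿ 3))
s₂ = const (+ 7) ⊗ (y⁴ ⊗ t ^ᴿ 2) ⊞ ⊟ (const (+ 4) ⊗ q ⊗ (y⁴ ⊗ τ)) ⊞ const (+ 16) ⊗ (q ⊗ q) ⊗ (y⁴ ⊗ τ ^ᴿ 4)

C⊗C : C ⊗ C ≈ tri s₀ s₁ s₂
C⊗C = PSR.trans (tri-⊗ c₀ c₁ c₂ c₀ c₁ c₂) (tri-cong e₀ e₁ e₂)
  where
  :c₀ :c₁ :c₂ : ∀ {n} (q y t τ : Polynomial n) → Polynomial n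
  :c₀ q y t τ = y :* y :* (t :* t :- con (+ 2) :* q :* τ)
  :c₁ q y t τ = y :* y :* (t :+ con (+ 4) :* q :* (τ :* τ))
  :c₂ q y t τ = y :* y :* con (+ 3)
  e₀ : c₀ ⊗ c₀ ⊞ q ⊗ (c₁ ⊗ c₂ ⊞ c₂ ⊗ c₁) ≈ s₀
  e₀ = lincomb (⊟ (const (+ 4) ⊗ q ⊗ t ⊗ y⁴))
    (solve 4 (λ q y t τ → let a = :c₀ q y t τ ; b = :c₁ q y t τ ; c = :c₂ q y t τ ; k = :- (con (+ 4) :* q :* t :* y :^ 4) in
        a :* a :+ q :* (b :* c :+ c :* b) :+ k :* q :^ 0
      := y :^ 4 :* t :^ 4 :+ con (+ 2) :* q :* (y :^ 4 :* t) :+ con (+ 28) :* (q :* q) :* (y :^ 4 :* τ :^ 2) :+ k :* (t :* τ))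
      PSR.refl q y t τ) t⊗τ
  e₁ : c₀ ⊗ c₁ ⊞ c₁ ⊗ c₀ ⊞ q ⊗ (c₂ ⊗ c₂) ≈ s₁
  -- With s = tτ the coefficient of q is 8s² - 4s + 9 = 13 + 4(2s + 1)(s - 1).
  e₁ = lincomb (const (+ 4) ⊗ q ⊗ (const (+ 2) ⊗ (t ⊗ τ) ⊞ 𝟙) ⊗ y⁴)
    (solve 4 (λ q y t τ → let a = :c₀ q y t τ ; b = :c₁ q y t τ ; c = :c₂ q y t τ
                              k = con (+ 4) :* q :* (con (+ 2) :* (t :* τ) :+ q :^ 0) :* y :^ 4 in
        a :* b :+ b :* a :+ q :* (c :* c) :+ k :* q :^ 0
      := con (+ 2) :* (y :^ 4 :* t :^ 3) :+ con (+ 13) :* q :* y :^ 4 :- con (+ 16) :* (q :* q) :* (y :^ 4 :* τ :^ 3) :+ k :* (t :* τ))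
      PSR.refl q y t τ) t⊗τ
  e₂ : c₀ ⊗ c₂ ⊞ c₁ ⊗ c₁ ⊞ c₂ ⊗ c₀ ≈ s₂
  e₂ = lincomb (const (+ 8) ⊗ q ⊗ τ ⊗ y⁴)
    (solve 4 (λ q y t τ → let a = :c₀ q y t τ ; b = :c₁ q y t τ ; c = :c₂ q y t τ ; k = con (+ 8) :* q :* τ :* y :^ 4 in
        a :* c :+ b :* b :+ c :* a :+ k :* q :^ 0
      := con (+ 7) :* (y :^ 4 :* t :^ 2) :- con (+ 4) :* q :* (y :^ 4 :* τ) :+ con (+ 16) :* (q :* q) :* (y :^ 4 :* τ :^ 4) :+ k :* (t :* τ))
      PSR.refl q y t τ) t⊗τ

dil-^ : ∀ a k → dil (a ^ᴿ k) ≈ dil a ^ᴿ k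
dil-^ a zero    = dil-𝟙
dil-^ a (suc k) = PSR.trans (dil-⊗ a (a ^ᴿ k)) (⊗-congˡ (dil a) (dil-^ a k))

^ᴿ-cong : ∀ {a b} → a ≈ b → ∀ k → a ^ᴿ k ≈ b ^ᴿ k
^ᴿ-cong e zero    = PSR.refl
^ᴿ-cong e (suc k) = ⊗-cong e (^ᴿ-cong e k)

dil-⊗-tri : ∀ m a b c → dil m ⊗ tri a b c ≈ tri (m ⊗ a) (m ⊗ b) (m ⊗ c)
dil-⊗-tri m a b c = PSR.trans (⊗-congˡ (dil m) (tri-dil a b c)) (PSR.trans
  (solve 5 (λ q m a b c → m :* (a :+ q :* b :+ q :* (q :* c)) := m :* a :+ q :* (m :* b) :+ q :* (q :* (m :* c)))
    PSR.refl q (dil m) (dil a) (dil b) (dil c))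
  (PSR.sym (PSR.trans (tri-dil (m ⊗ a) (m ⊗ b) (m ⊗ c))
    (⊞-cong (⊞-cong (dil-⊗ m a) (⊗-congˡ q (dil-⊗ m b))) (⊗-congˡ q (⊗-congˡ q (dil-⊗ m c)))))))

-- The three components of the generating function

-- f₃⁶f₆⁶ is a series in q³ and passes through the trisection as f₁⁶f₂⁶; `M₀` is this times the
-- squared inverse norm, left uncancelled so that `dil` acts factor by factor. Its product with y⁴
-- is f₃⁶f₆⁶/(f₁²f₂²) again, so each term of the theorem is the generating function times a power of
-- t, up to a constant and a power of q.
CPη M₀ : Monomial 8
CPη = F₃ ^ᴹ 6 ∙ F₆ ^ᴹ 6 ∙ I₁ ^ᴹ 2 ∙ I₂ ^ᴹ 2
M₀ = F₁ ^ᴹ 6 ∙ F₂ ^ᴹ 6 ∙ (F₃ ∙ F₆ ∙ (I₁ ∙ I₂) ^ᴹ 4) ∙ (F₃ ∙ F₆ ∙ (I₁ ∙ I₂) ^ᴹ 4)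

m₀ : PS
m₀ = ⟦ M₀ ⟧η

i₁i₂ : f⁻¹ 1 ⊗ f⁻¹ 2 ≈ C ⊗ dil ν⁻¹
i₁i₂ = inverse-unique {f 1 ⊗ f 2} (eta≈ (F₁ ∙ F₂ ∙ (I₁ ∙ I₂)) ε 1 1 0 0 refl)
  (PSR.trans (PSR.sym (PSR.*-assoc (f 1 ⊗ f 2) C (dil ν⁻¹))) (PSR.trans (⊗-congʳ (dil ν⁻¹) f₁f₂⊗C)
    (PSR.trans (PSR.sym (dil-⊗ ν ν⁻¹)) (PSR.trans (dil-cong ν⊗ν⁻¹) dil-𝟙))))

CP-trisect : ⟦ CPη ⟧η ≈ tri (m₀ ⊗ s₀) (m₀ ⊗ s₁) (m₀ ⊗ s₂)
CP-trisect = begin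
  ⟦ CPη ⟧η
    ≈⟨ eta≈ CPη (F₃ ^ᴹ 6 ∙ F₆ ^ᴹ 6 ∙ ((I₁ ∙ I₂) ∙ (I₁ ∙ I₂))) 0 0 0 0 refl ⟩
  f 3 ^ᴿ 6 ⊗ f 6 ^ᴿ 6 ⊗ ((f⁻¹ 1 ⊗ f⁻¹ 2) ⊗ (f⁻¹ 1 ⊗ f⁻¹ 2))
    ≈⟨ ⊗-cong (⊗-cong (dil-f^ 0) (dil-f^ 1)) (⊗-cong (PSR.sym i₁i₂) (PSR.sym i₁i₂)) ⟨
  dil (f 1 ^ᴿ 6) ⊗ dil (f 2 ^ᴿ 6) ⊗ ((C ⊗ D) ⊗ (C ⊗ D))
    ≈⟨ solveᴹ 4 (λ a b c d → a ∙ b ∙ ((c ∙ d) ∙ (c ∙ d)) ≜ a ∙ b ∙ d ∙ d ∙ (c ∙ c)) PSR.refl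
         (dil (f 1 ^ᴿ 6)) (dil (f 2 ^ᴿ 6)) C D ⟩
  dil (f 1 ^ᴿ 6) ⊗ dil (f 2 ^ᴿ 6) ⊗ D ⊗ D ⊗ (C ⊗ C)
    ≈⟨ ⊗-cong (PSR.sym dil-m₀) C⊗C ⟩
  dil m₀ ⊗ tri s₀ s₁ s₂
    ≈⟨ dil-⊗-tri m₀ s₀ s₁ s₂ ⟩
  tri (m₀ ⊗ s₀) (m₀ ⊗ s₁) (m₀ ⊗ s₂) ∎
  where
  open SetoidReasoning PSR.setoid
  D : PS
  D = dil ν⁻¹
  dil-f^ : ∀ m → dil (f (suc m) ^ᴿ 6) ≈ f (3 ℕ.* suc m) ^ᴿ 6
  dil-f^ m = PSR.trans (dil-^ (f (suc m)) 6) (^ᴿ-cong (dil-f m) 6)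
  dil-m₀ : dil m₀ ≈ dil (f 1 ^ᴿ 6) ⊗ dil (f 2 ^ᴿ 6) ⊗ D ⊗ D
  dil-m₀ = PSR.trans (dil-⊗ (f 1 ^ᴿ 6 ⊗ f 2 ^ᴿ 6 ⊗ ν⁻¹) ν⁻¹) (⊗-congʳ D
    (PSR.trans (dil-⊗ (f 1 ^ᴿ 6 ⊗ f 2 ^ᴿ 6) ν⁻¹) (⊗-congʳ D (dil-⊗ (f 1 ^ᴿ 6) (f 2 ^ᴿ 6)))))

-- Products in the theorem nest to the left with the scalar and power of q innermost; these lemmas
-- bring that prefix out, leaving a pure eta quotient.
assoc₂ : ∀ k a b → k ⊗ a ⊗ b ≈ k ⊗ (a ⊗ b)
assoc₂ = PSR.*-assoc

assoc₃ : ∀ k a b c → k ⊗ a ⊗ b ⊗ c ≈ k ⊗ (a ⊗ b ⊗ c)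
assoc₃ k a b c = PSR.trans (⊗-congʳ c (assoc₂ k a b)) (PSR.*-assoc k (a ⊗ b) c)

assoc₄ : ∀ k a b c d → k ⊗ a ⊗ b ⊗ c ⊗ d ≈ k ⊗ (a ⊗ b ⊗ c ⊗ d)
assoc₄ k a b c d = PSR.trans (⊗-congʳ d (assoc₃ k a b c)) (PSR.*-assoc k (a ⊗ b ⊗ c) d)

q⊗q : q ⊗ q ≈ qpow 2
q⊗q = PSR.sym (qpow-+ 1 1)

part₀ : m₀ ⊗ s₀ ≈ f 2 ^ᴿ 2 ⊗ f 3 ^ᴿ 18 ⊗ f⁻¹ 1 ^ᴿ 6 ⊗ f⁻¹ 6 ^ᴿ 6
  ⊞ const (+ 2) ⊗ qpow 1 ⊗ f 3 ^ᴿ 9 ⊗ f 6 ^ᴿ 3 ⊗ f⁻¹ 1 ^ᴿ 3 ⊗ f⁻¹ 2 ^ᴿ 1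
  ⊞ const (+ 28) ⊗ qpow 2 ⊗ f 6 ^ᴿ 12 ⊗ f⁻¹ 2 ^ᴿ 4
part₀ = PSR.trans
  (solve 7 (λ m u v w k l j → m :* (u :+ k :* j :* v :+ l :* (j :* j) :* w)
       := m :* u :+ k :* j :* (m :* v) :+ l :* (j :* j) :* (m :* w))
     PSR.refl m₀ (y⁴ ⊗ t ^ᴿ 4) (y⁴ ⊗ t) (y⁴ ⊗ τ ^ᴿ 2) (const (+ 2)) (const (+ 28)) q)
  (⊞-cong (⊞-cong
    (eta≈ (M₀ ∙ (Y ^ᴹ 4 ∙ T ^ᴹ 4)) (F₂ ^ᴹ 2 ∙ F₃ ^ᴹ 18 ∙ I₁ ^ᴹ 6 ∙ I₆ ^ᴹ 6) 6 8 0 6 refl)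
    (PSR.trans (⊗-congˡ (const (+ 2) ⊗ q)
        (eta≈ (M₀ ∙ (Y ^ᴹ 4 ∙ T)) (F₃ ^ᴹ 9 ∙ F₆ ^ᴹ 3 ∙ I₁ ^ᴹ 3 ∙ I₂ ^ᴹ 1) 6 7 0 3 refl))
      (PSR.sym (assoc₄ (const (+ 2) ⊗ q) (f 3 ^ᴿ 9) (f 6 ^ᴿ 3) (f⁻¹ 1 ^ᴿ 3) (f⁻¹ 2 ^ᴿ 1)))))
    (PSR.trans (⊗-cong (⊗-congˡ (const (+ 28)) q⊗q)
        (eta≈ (M₀ ∙ (Y ^ᴹ 4 ∙ T⁻¹ ^ᴹ 2)) (F₆ ^ᴹ 12 ∙ I₂ ^ᴹ 4) 8 6 6 0 refl))
      (PSR.sym (assoc₂ (const (+ 28) ⊗ qpow 2) (f 6 ^ᴿ 12) (f⁻¹ 2 ^ᴿ 4)))))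

part₁ : m₀ ⊗ s₁ ≈ const (+ 2) ⊗ f 2 ^ᴿ 1 ⊗ f 3 ^ᴿ 15 ⊗ f⁻¹ 1 ^ᴿ 5 ⊗ f⁻¹ 6 ^ᴿ 3
  ⊞ const (+ 13) ⊗ qpow 1 ⊗ f 3 ^ᴿ 6 ⊗ f 6 ^ᴿ 6 ⊗ f⁻¹ 1 ^ᴿ 2 ⊗ f⁻¹ 2 ^ᴿ 2
  ⊞ ⊟ (const (+ 16) ⊗ qpow 2 ⊗ f 1 ^ᴿ 1 ⊗ f 6 ^ᴿ 15 ⊗ f⁻¹ 2 ^ᴿ 5 ⊗ f⁻¹ 3 ^ᴿ 3)
part₁ = PSR.trans
  (solve 8 (λ m u v w h k l j → m :* (h :* u :+ k :* j :* v :- l :* (j :* j) :* w)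
       := h :* (m :* u) :+ k :* j :* (m :* v) :- l :* (j :* j) :* (m :* w))
     PSR.refl m₀ (y⁴ ⊗ t ^ᴿ 3) y⁴ (y⁴ ⊗ τ ^ᴿ 3) (const (+ 2)) (const (+ 13)) (const (+ 16)) q)
  (⊞-cong (⊞-cong
    (PSR.trans (⊗-congˡ (const (+ 2))
        (eta≈ (M₀ ∙ (Y ^ᴹ 4 ∙ T ^ᴹ 3)) (F₂ ^ᴹ 1 ∙ F₃ ^ᴹ 15 ∙ I₁ ^ᴹ 5 ∙ I₆ ^ᴹ 3) 6 8 0 6 refl))
      (PSR.sym (assoc₄ (const (+ 2)) (f 2 ^ᴿ 1) (f 3 ^ᴿ 15) (f⁻¹ 1 ^ᴿ 5) (f⁻¹ 6 ^ᴿ 3))))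
    (PSR.trans (⊗-congˡ (const (+ 13) ⊗ q)
        (eta≈ (M₀ ∙ Y ^ᴹ 4) (F₃ ^ᴹ 6 ∙ F₆ ^ᴹ 6 ∙ I₁ ^ᴹ 2 ∙ I₂ ^ᴹ 2) 6 6 0 0 refl))
      (PSR.sym (assoc₄ (const (+ 13) ⊗ q) (f 3 ^ᴿ 6) (f 6 ^ᴿ 6) (f⁻¹ 1 ^ᴿ 2) (f⁻¹ 2 ^ᴿ 2)))))
    (⊟-cong (PSR.trans (⊗-cong (⊗-congˡ (const (+ 16)) q⊗q)
        (eta≈ (M₀ ∙ (Y ^ᴹ 4 ∙ T⁻¹ ^ᴹ 3)) (F₁ ^ᴹ 1 ∙ F₆ ^ᴹ 15 ∙ I₂ ^ᴹ 5 ∙ I₃ ^ᴹ 3) 8 6 6 0 refl))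
      (PSR.sym (assoc₄ (const (+ 16) ⊗ qpow 2) (f 1 ^ᴿ 1) (f 6 ^ᴿ 15) (f⁻¹ 2 ^ᴿ 5) (f⁻¹ 3 ^ᴿ 3))))))

part₂ : m₀ ⊗ s₂ ≈ const (+ 7) ⊗ f 3 ^ᴿ 12 ⊗ f⁻¹ 1 ^ᴿ 4
  ⊞ ⊟ (const (+ 4) ⊗ qpow 1 ⊗ f 3 ^ᴿ 3 ⊗ f 6 ^ᴿ 9 ⊗ f⁻¹ 1 ^ᴿ 1 ⊗ f⁻¹ 2 ^ᴿ 3)
  ⊞ const (+ 16) ⊗ qpow 2 ⊗ f 1 ^ᴿ 2 ⊗ f 6 ^ᴿ 18 ⊗ f⁻¹ 2 ^ᴿ 6 ⊗ f⁻¹ 3 ^ᴿ 6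
part₂ = PSR.trans
  (solve 8 (λ m u v w h k l j → m :* (h :* u :- k :* j :* v :+ l :* (j :* j) :* w)
       := h :* (m :* u) :- k :* j :* (m :* v) :+ l :* (j :* j) :* (m :* w))
     PSR.refl m₀ (y⁴ ⊗ t ^ᴿ 2) (y⁴ ⊗ τ) (y⁴ ⊗ τ ^ᴿ 4) (const (+ 7)) (const (+ 4)) (const (+ 16)) q)
  (⊞-cong (⊞-cong
    (PSR.trans (⊗-congˡ (const (+ 7))
        (eta≈ (M₀ ∙ (Y ^ᴹ 4 ∙ T ^ᴹ 2)) (F₃ ^ᴹ 12 ∙ I₁ ^ᴹ 4) 6 8 0 6 refl))
      (PSR.sym (assoc₂ (const (+ 7)) (f 3 ^ᴿ 12) (f⁻¹ 1 ^ᴿ 4))))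
    (⊟-cong (PSR.trans (⊗-congˡ (const (+ 4) ⊗ q)
        (eta≈ (M₀ ∙ (Y ^ᴹ 4 ∙ T⁻¹)) (F₃ ^ᴹ 3 ∙ F₆ ^ᴹ 9 ∙ I₁ ^ᴹ 1 ∙ I₂ ^ᴹ 3) 7 6 3 0 refl))
      (PSR.sym (assoc₄ (const (+ 4) ⊗ q) (f 3 ^ᴿ 3) (f 6 ^ᴿ 9) (f⁻¹ 1 ^ᴿ 1) (f⁻¹ 2 ^ᴿ 3))))))
    (PSR.trans (⊗-cong (⊗-congˡ (const (+ 16)) q⊗q)
        (eta≈ (M₀ ∙ (Y ^ᴹ 4 ∙ T⁻¹ ^ᴹ 4)) (F₁ ^ᴹ 2 ∙ F₆ ^ᴹ 18 ∙ I₂ ^ᴹ 6 ∙ I₃ ^ᴹ 6) 8 6 6 0 refl))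
      (PSR.sym (assoc₄ (const (+ 16) ⊗ qpow 2) (f 1 ^ᴿ 2) (f 6 ^ᴿ 18) (f⁻¹ 2 ^ᴿ 6) (f⁻¹ 3 ^ᴿ 6)))))

-- Transfer to the operations of the statement

opaque
  unfolding _⊗_

  seal-⊕ : ∀ {a a′ b b′} → a ≈ a′ → b ≈ b′ → a ⊕ b ≈ a′ ⊞ b′
  seal-⊕ = ⊞-cong

  seal-⊖ : ∀ {a a′ b b′} → a ≈ a′ → b ≈ b′ → a ⊖ b ≈ a′ ⊞ ⊟ b′
  seal-⊖ e e′ = ⊞-cong e (⊟-cong e′)

  seal-⊛ : ∀ {a a′ b b′} → a ≈ a′ → b ≈ b′ → a ⊛ b ≈ a′ ⊗ b′
  seal-⊛ = ⊗-cong

  seal-· : ∀ c {a a′} → a ≈ a′ → c · a ≈ const c ⊗ a′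
  seal-· c {a} {a′} e = pointwise λ n → trans (cong (λ z → c ℤ.* z) (at e n tt)) (sym (const-⊛-at c a′ n))

seal-^ : ∀ a k → a ^ k ≈ a ^ᴿ k
seal-^ a zero    = PSR.refl
seal-^ a (suc k) = seal-⊛ (PSR.refl {a}) (seal-^ a k)

infixl 7 _⟨⊛⟩_
_⟨⊛⟩_ : ∀ {a a′ b b′} → a ≈ a′ → b ≈ b′ → a ⊛ b ≈ a′ ⊗ b′
_⟨⊛⟩_ = seal-⊛

-- The nesting copies the statement term by term, so the inferred left side is the stated series and
-- no product has to be unfolded.
rhs₀ = seal-⊕ (seal-⊕
  (seal-^ (f 2) 2 ⟨⊛⟩ seal-^ (f 3) 18 ⟨⊛⟩ seal-^ (f⁻¹ 1) 6 ⟨⊛⟩ seal-^ (f⁻¹ 6) 6)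
  (seal-· (+ 2) (PSR.refl {qpow 1}) ⟨⊛⟩ seal-^ (f 3) 9 ⟨⊛⟩ seal-^ (f 6) 3 ⟨⊛⟩ seal-^ (f⁻¹ 1) 3 ⟨⊛⟩ seal-^ (f⁻¹ 2) 1))
  (seal-· (+ 28) (PSR.refl {qpow 2}) ⟨⊛⟩ seal-^ (f 6) 12 ⟨⊛⟩ seal-^ (f⁻¹ 2) 4)

rhs₁ = seal-⊖ (seal-⊕
  (seal-· (+ 2) (seal-^ (f 2) 1) ⟨⊛⟩ seal-^ (f 3) 15 ⟨⊛⟩ seal-^ (f⁻¹ 1) 5 ⟨⊛⟩ seal-^ (f⁻¹ 6) 3)
  (seal-· (+ 13) (PSR.refl {qpow 1}) ⟨⊛⟩ seal-^ (f 3) 6 ⟨⊛⟩ seal-^ (f 6) 6 ⟨⊛⟩ seal-^ (f⁻¹ 1) 2 ⟨⊛⟩ seal-^ (f⁻¹ 2) 2))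
  (seal-· (+ 16) (PSR.refl {qpow 2}) ⟨⊛⟩ seal-^ (f 1) 1 ⟨⊛⟩ seal-^ (f 6) 15 ⟨⊛⟩ seal-^ (f⁻¹ 2) 5 ⟨⊛⟩ seal-^ (f⁻¹ 3) 3)

rhs₂ = seal-⊕ (seal-⊖
  (seal-· (+ 7) (seal-^ (f 3) 12) ⟨⊛⟩ seal-^ (f⁻¹ 1) 4)
  (seal-· (+ 4) (PSR.refl {qpow 1}) ⟨⊛⟩ seal-^ (f 3) 3 ⟨⊛⟩ seal-^ (f 6) 9 ⟨⊛⟩ seal-^ (f⁻¹ 1) 1 ⟨⊛⟩ seal-^ (f⁻¹ 2) 3))
  (seal-· (+ 16) (PSR.refl {qpow 2}) ⟨⊛⟩ seal-^ (f 1) 2 ⟨⊛⟩ seal-^ (f 6) 18 ⟨⊛⟩ seal-^ (f⁻¹ 2) 6 ⟨⊛⟩ seal-^ (f⁻¹ 3) 6)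

CP3-seal = seal-^ (f 3) 6 ⟨⊛⟩ seal-^ (f 6) 6 ⟨⊛⟩ seal-^ (f⁻¹ 1) 2 ⟨⊛⟩ seal-^ (f⁻¹ 2) 2

open import Data.Nat using (_+_; _*_)

theorem3p3 : (∀ (n : ℕ) → CP3 (3 * n) ≡
    ( f 2 ^ 2 ⊛ f 3 ^ 18 ⊛ f⁻¹ 1 ^ 6 ⊛ f⁻¹ 6 ^ 6
    ⊕ (+ 2) · qpow 1 ⊛ f 3 ^ 9 ⊛ f 6 ^ 3 ⊛ f⁻¹ 1 ^ 3 ⊛ f⁻¹ 2 ^ 1
    ⊕ (+ 28) · qpow 2 ⊛ f 6 ^ 12 ⊛ f⁻¹ 2 ^ 4 ) n)
    × (∀ (n : ℕ) → CP3 (3 * n + 1) ≡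
    ( (+ 2) · f 2 ^ 1 ⊛ f 3 ^ 15 ⊛ f⁻¹ 1 ^ 5 ⊛ f⁻¹ 6 ^ 3
    ⊕ (+ 13) · qpow 1 ⊛ f 3 ^ 6 ⊛ f 6 ^ 6 ⊛ f⁻¹ 1 ^ 2 ⊛ f⁻¹ 2 ^ 2
    ⊖ (+ 16) · qpow 2 ⊛ f 1 ^ 1 ⊛ f 6 ^ 15 ⊛ f⁻¹ 2 ^ 5 ⊛ f⁻¹ 3 ^ 3 ) n)
    × (∀ (n : ℕ) → CP3 (3 * n + 2) ≡
    ( (+ 7) · f 3 ^ 12 ⊛ f⁻¹ 1 ^ 4
    ⊖ (+ 4) · qpow 1 ⊛ f 3 ^ 3 ⊛ f 6 ^ 9 ⊛ f⁻¹ 1 ^ 1 ⊛ f⁻¹ 2 ^ 3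
    ⊕ (+ 16) · qpow 2 ⊛ f 1 ^ 2 ⊛ f 6 ^ 18 ⊛ f⁻¹ 2 ^ 6 ⊛ f⁻¹ 3 ^ 6 ) n)
theorem3p3 =
    (λ n → trans (CP3-trisect (3 * n)) (trans (cong S (ℕₚ.*-comm 3 n))
      (trans (at (comp₀-tri S₀ S₁ S₂) n tt) (trans (at part₀ n tt) (sym (at rhs₀ n tt))))))
  , (λ n → trans (CP3-trisect (3 * n + 1)) (trans (cong S (index n 1))
      (trans (at (comp₁-tri S₀ S₁ S₂) n tt) (trans (at part₁ n tt) (sym (at rhs₁ n tt))))))
  , (λ n → trans (CP3-trisect (3 * n + 2)) (trans (cong S (index n 2))
      (trans (at (comp₂-tri S₀ S₁ S₂) n tt) (trans (at part₂ n tt) (sym (at rhs₂ n tt))))))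
  where
  S₀ S₁ S₂ S : PS
  S₀ = m₀ ⊗ s₀
  S₁ = m₀ ⊗ s₁
  S₂ = m₀ ⊗ s₂
  S = tri S₀ S₁ S₂
  CP3-trisect : ∀ n → CP3 n ≡ S n
  CP3-trisect n = trans (at CP3-seal n tt) (at CP-trisect n tt)
  index : ∀ n i → 3 * n + i ≡ i + n * 3
  index n i = trans (ℕₚ.+-comm (3 * n) i) (cong (λ k → i + k) (ℕₚ.*-comm 3 n))
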